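{- The functions $\mathsf{emb}_{\mathsf{RI}}$ and $\mathsf{focus}$ define, for every stoup $S$, context $\Gamma$ and formula $A$, a bijective correspondence between the set of derivations of $S\mid\Gamma\vdash A$ in the sequent calculus quotiented by the equivalence relation $\circeq$, and the set of derivations of the untagged sequent $S\mid\Gamma\vdash_{\mathsf{RI}}A$ in the focused sequent calculus with tag annotations. That is: (1) for all derivations $f,g$ of $S\mid\Gamma\vdash A$, if $f\circeq g$ then $\mathsf{focus}\,f=\mathsf{focus}\,g$; (2) for every derivation $f$ of $S\mid\Gamma\vdash A$, $\mathsf{emb}_{\mathsf{RI}}(\mathsf{focus}\,f)\circeq f$; (3) for every derivation $f$ of $S\mid\Gamma\vdash_{\mathsf{RI}}A$, $\mathsf{focus}(\mathsf{emb}_{\mathsf{RI}}\,f)=f$.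
   Context: Fix a set $\mathsf{At}$ of atomic formulae. Formulae are generated by $A,B ::= X \mid \mathsf{I} \mid A\otimes B \mid A\wedge B \mid A\vee B$ with $X\in\mathsf{At}$. A stoup $S$ is either empty (written $-$) or a single formula. A context $\Gamma$ is a finite ordered list of formulae (possibly empty); a comma denotes concatenation. A sequent is a triple $S\mid\Gamma\vdash A$ with $S$ a stoup, $\Gamma$ a context and $A$ a formula. We write $f:S\mid\Gamma\vdash A$ for a derivation $f$ of that sequent, and use rule names as operations on derivations. Sequent calculus. Derivations are inductively generated by the following rules (premises $\Rightarrow$ conclusion): - $\mathsf{ax}$: (no premise) $\Rightarrow A\mid\;\vdash A$ (empty context), for any formula $A$ (written $\mathsf{ax}_A$); - $\mathsf{pass}$: $A\mid\Gamma\vdash C \Rightarrow { - }\mid A,\Gamma\vdash C$; - $\mathsf{IL}$: ${ - }\mid\Gamma\vdash C \Rightarrow \mathsf{I}\mid\Gamma\vdash C$; - $\mathsf{IR}$: (no premise) $\Rightarrow { - }\mid\;\vdash\mathsf{I}$; - $\otimes\mathsf{L}$: $A\mid B,\Gamma\vdash C \Rightarrow A\otimes B\mid\Gamma\vdash C$; - $\otimes\mathsf{R}$: $S\mid\Gamma\vdash A$ and ${ - }\mid\Delta\vdash B \Rightarrow S\mid\Gamma,\Delta\vdash A\otimes B$; - $\wedge\mathsf{L}_1$: $A\mid\Gamma\vdash C\Rightarrow A\wedge B\mid\Gamma\vdash C$; $\wedge\mathsf{L}_2$: $B\mid\Gamma\vdash C\Rightarrow A\wedge B\mid\Gamma\vdash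 C$; - $\wedge\mathsf{R}$: $S\mid\Gamma\vdash A$ and $S\mid\Gamma\vdash B\Rightarrow S\mid\Gamma\vdash A\wedge B$; - $\vee\mathsf{L}$: $A\mid\Gamma\vdash C$ and $B\mid\Gamma\vdash C\Rightarrow A\vee B\mid\Gamma\vdash C$; - $\vee\mathsf{R}_1$: $S\mid\Gamma\vdash A\Rightarrow S\mid\Gamma\vdash A\vee B$; $\vee\mathsf{R}_2$: $S\mid\Gamma\vdash B\Rightarrow S\mid\Gamma\vdash A\vee B$. The relation $\circeq$ is the least congruence (equivalence relation on derivations of each sequent, compatible with all rules) containing the following equations, for all well-typed $f,g,f_i,g_i$ and $i,j\in\{1,2\}$: $\mathsf{ax}_{\mathsf{I}}\circeq\mathsf{IL}(\mathsf{IR})$; $\mathsf{ax}_{A\otimes B}\circeq\otimes\mathsf{L}(\otimes\mathsf{R}(\mathsf{ax}_A,\mathsf{pass}\,\mathsf{ax}_B))$; $\mathsf{ax}_{A\wedge B}\circeq\wedge\mathsf{R}(\wedge\mathsf{L}_1\mathsf{ax}_A,\wedge\mathsf{L}_2\mathsf{ax}_B)$; $\mathsf{ax}_{A\vee B}\circeq\vee\mathsf{L}(\vee\mathsf{R}_1\mathsf{ax}_A,\vee\mathsf{R}_2\mathsf{ax}_B)$; $\otimes\mathsf{R}(\mathsf{pass}\,f,g)\circeq\mathsf{pass}(\otimes\mathsf{R}(f,g))$; $\otimes\mathsf{R}(\mathsf{IL}\,f,g)\circeq\mathsf{IL}(\otimes\mathsf{R}(f,g))$; $\otimes\mathsf{R}(\otimes\mathsf{L}\,f,g)\circeq\otimes\mathsf{L}(\otimes\mathsf{R}(f,g))$;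 $\otimes\mathsf{R}(\wedge\mathsf{L}_i\,f,g)\circeq\wedge\mathsf{L}_i(\otimes\mathsf{R}(f,g))$; $\otimes\mathsf{R}(\vee\mathsf{L}(f_1,f_2),g)\circeq\vee\mathsf{L}(\otimes\mathsf{R}(f_1,g),\otimes\mathsf{R}(f_2,g))$; $\mathsf{pass}(\wedge\mathsf{R}(f,g))\circeq\wedge\mathsf{R}(\mathsf{pass}\,f,\mathsf{pass}\,g)$; $\mathsf{IL}(\wedge\mathsf{R}(f,g))\circeq\wedge\mathsf{R}(\mathsf{IL}\,f,\mathsf{IL}\,g)$; $\otimes\mathsf{L}(\wedge\mathsf{R}(f,g))\circeq\wedge\mathsf{R}(\otimes\mathsf{L}\,f,\otimes\mathsf{L}\,g)$; $\wedge\mathsf{L}_i(\wedge\mathsf{R}(f,g))\circeq\wedge\mathsf{R}(\wedge\mathsf{L}_i\,f,\wedge\mathsf{L}_i\,g)$; $\vee\mathsf{L}(\wedge\mathsf{R}(f_1,g_1),\wedge\mathsf{R}(f_2,g_2))\circeq\wedge\mathsf{R}(\vee\mathsf{L}(f_1,f_2),\vee\mathsf{L}(g_1,g_2))$; $\vee\mathsf{R}_i(\mathsf{pass}\,f)\circeq\mathsf{pass}(\vee\mathsf{R}_i\,f)$; $\vee\mathsf{R}_i(\mathsf{IL}\,f)\circeq\mathsf{IL}(\vee\mathsf{R}_i\,f)$; $\vee\mathsf{R}_i(\otimes\mathsf{L}\,f)\circeq\otimes\mathsf{L}(\vee\mathsf{R}_i\,f)$; $\vee\mathsf{R}_i(\wedge\mathsf{L}_j\,f)\circeq\wedge\mathsf{L}_j(\vee\mathsf{R}_i\,f)$;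 $\vee\mathsf{R}_i(\vee\mathsf{L}(f,g))\circeq\vee\mathsf{L}(\vee\mathsf{R}_i\,f,\vee\mathsf{R}_i\,g)$. Focused sequent calculus with tag annotations. A formula is non-negative if its principal connective is not $\wedge$; $P$ always denotes a non-negative formula. A stoup is irreducible if it is empty, an atom, or a formula with principal connective $\wedge$ (i.e. it is not $\mathsf{I}$ and its principal connective is neither $\otimes$ nor $\vee$); $T$ always denotes an irreducible stoup. There are four tags $\mathbb{P},\mathbb{C}_1,\mathbb{C}_2,\mathbb{R}$. A list of tags $l$ is valid if it is non-empty and either $\mathbb{R}\in l$, or both $\mathbb{C}_1\in l$ and $\mathbb{C}_2\in l$. Sequents come in three phases $\vdash_{\mathsf{RI}},\vdash_{\mathsf{LI}},\vdash_{\mathsf{F}}$; an $\mathsf{RI}$-sequent is either untagged or carries a list of tags $l$ (written $\vdash^l_{\mathsf{RI}}$), and an $\mathsf{LI}$- or $\mathsf{F}$-sequent is either untagged or carries a single tag $t$ (written $\vdash^t_{\mathsf{LI}}$, $\vdash^t_{\mathsf{F}}$). A question mark, as in $l?$ or $t?$, means that the rule exists both in a version where the annotated sequents are all untagged and in a version where they all carry the indicated tags. A single tag $t$ on an $\mathsf{RI}$-sequent means the singleton list $[t]$. Rules: - $\wedge\mathsf{R}$: $S\mid\Gamma\vdash^{l_1?}_{\mathsf{RI}}A$ and $S\mid\Gamma\vdash^{l_2?}_{\mathsf{RI}}B\Rightarrow S\mid\Gamma\vdash^{l_1?,l_2?}_{\mathsf{RI}}A\wedge B$ (tagged version: the conclusion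 carries the concatenation $l_1,l_2$); - $\mathsf{LI2RI}$: $S\mid\Gamma\vdash^{t?}_{\mathsf{LI}}P\Rightarrow S\mid\Gamma\vdash^{t?}_{\mathsf{RI}}P$; - $\mathsf{IL}$: ${ - }\mid\Gamma\vdash_{\mathsf{LI}}P\Rightarrow\mathsf{I}\mid\Gamma\vdash_{\mathsf{LI}}P$; - $\otimes\mathsf{L}$: $A\mid B,\Gamma\vdash_{\mathsf{LI}}P\Rightarrow A\otimes B\mid\Gamma\vdash_{\mathsf{LI}}P$; - $\vee\mathsf{L}$: $A\mid\Gamma\vdash_{\mathsf{LI}}P$ and $B\mid\Gamma\vdash_{\mathsf{LI}}P\Rightarrow A\vee B\mid\Gamma\vdash_{\mathsf{LI}}P$; - $\mathsf{F2LI}$: $T\mid\Gamma\vdash^{t?}_{\mathsf{F}}P\Rightarrow T\mid\Gamma\vdash^{t?}_{\mathsf{LI}}P$; - $\mathsf{pass}$: $A\mid\Gamma\vdash_{\mathsf{LI}}P\Rightarrow{ - }\mid A,\Gamma\vdash^{\mathbb{P}?}_{\mathsf{F}}P$; - $\mathsf{ax}$: (no premise) $\Rightarrow X\mid\;\vdash^{\mathbb{R}?}_{\mathsf{F}}X$ for $X$ atomic; $\mathsf{IR}$: (no premise) $\Rightarrow{ - }\mid\;\vdash^{\mathbb{R}?}_{\mathsf{F}}\mathsf{I}$; - $\otimes\mathsf{R}$: $T\mid\Gamma\vdash^{l}_{\mathsf{RI}}A$ and ${ - }\mid\Delta\vdash_{\mathsf{RI}}B$, with $l$ valid, $\Rightarrow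 T\mid\Gamma,\Delta\vdash^{\mathbb{R}?}_{\mathsf{F}}A\otimes B$; - $\vee\mathsf{R}_1$: $T\mid\Gamma\vdash^{l}_{\mathsf{RI}}A$, with $l$ valid, $\Rightarrow T\mid\Gamma\vdash^{\mathbb{R}?}_{\mathsf{F}}A\vee B$; $\vee\mathsf{R}_2$: $T\mid\Gamma\vdash^{l}_{\mathsf{RI}}B$, with $l$ valid, $\Rightarrow T\mid\Gamma\vdash^{\mathbb{R}?}_{\mathsf{F}}A\vee B$; - $\wedge\mathsf{L}_1$: $A\mid\Gamma\vdash_{\mathsf{LI}}P\Rightarrow A\wedge B\mid\Gamma\vdash^{\mathbb{C}_1?}_{\mathsf{F}}P$; $\wedge\mathsf{L}_2$: $B\mid\Gamma\vdash_{\mathsf{LI}}P\Rightarrow A\wedge B\mid\Gamma\vdash^{\mathbb{C}_2?}_{\mathsf{F}}P$. The function $\mathsf{emb}_{ph}$ ($ph\in\{\mathsf{RI},\mathsf{LI},\mathsf{F}\}$) maps a (tagged or untagged) derivation of a sequent in phase $ph$ to a derivation of $S\mid\Gamma\vdash A$ by erasing all phase and tag annotations: the switching rules $\mathsf{LI2RI}$, $\mathsf{F2LI}$ are deleted and each other rule is sent to the rule of the same name. The function $\mathsf{focus}$ maps a derivation of $S\mid\Gamma\vdash A$ to a derivation of the untagged sequent $S\mid\Gamma\vdash_{\mathsf{RI}}A$, by structural recursion, replacing each rule $r$ by the operation $r^{\mathsf{RI}}$ on untagged $\mathsf{RI}$-derivations (e.g. $\mathsf{focus}(\vee\mathsf{R}_1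 f)=\vee\mathsf{R}_1^{\mathsf{RI}}(\mathsf{focus}\,f)$), and $\wedge\mathsf{R}$ by $\wedge\mathsf{R}$. These operations are: - For each unary rule $r\in\{\mathsf{IL},\otimes\mathsf{L},\mathsf{pass},\wedge\mathsf{L}_1,\wedge\mathsf{L}_2\}$: $r^{\mathsf{RI}}(\wedge\mathsf{R}(f,g))=\wedge\mathsf{R}(r^{\mathsf{RI}}f,r^{\mathsf{RI}}g)$; and $r^{\mathsf{RI}}(\mathsf{LI2RI}\,f)=\mathsf{LI2RI}(r\,f)$ if $r\in\{\mathsf{IL},\otimes\mathsf{L}\}$, while $r^{\mathsf{RI}}(\mathsf{LI2RI}\,f)=\mathsf{LI2RI}(\mathsf{F2LI}(r\,f))$ if $r\in\{\mathsf{pass},\wedge\mathsf{L}_1,\wedge\mathsf{L}_2\}$. - $\vee\mathsf{L}^{\mathsf{RI}}(\wedge\mathsf{R}(f_1,g_1),\wedge\mathsf{R}(f_2,g_2))=\wedge\mathsf{R}(\vee\mathsf{L}^{\mathsf{RI}}(f_1,f_2),\vee\mathsf{L}^{\mathsf{RI}}(g_1,g_2))$ and $\vee\mathsf{L}^{\mathsf{RI}}(\mathsf{LI2RI}\,f,\mathsf{LI2RI}\,g)=\mathsf{LI2RI}(\vee\mathsf{L}(f,g))$. - $\mathsf{IR}^{\mathsf{RI}}=\mathsf{LI2RI}(\mathsf{F2LI}(\mathsf{IR}))$. - $\mathsf{ax}^{\mathsf{RI}}_A$ is defined by recursion on $A$: $\mathsf{ax}^{\mathsf{RI}}_X=\mathsf{LI2RI}(\mathsf{F2LI}(\mathsf{ax}))$;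 $\mathsf{ax}^{\mathsf{RI}}_{\mathsf{I}}=\mathsf{IL}^{\mathsf{RI}}(\mathsf{IR}^{\mathsf{RI}})$; $\mathsf{ax}^{\mathsf{RI}}_{A\otimes B}=\otimes\mathsf{L}^{\mathsf{RI}}(\otimes\mathsf{R}^{\mathsf{RI}}(\mathsf{ax}^{\mathsf{RI}}_A,\mathsf{pass}^{\mathsf{RI}}\mathsf{ax}^{\mathsf{RI}}_B))$; $\mathsf{ax}^{\mathsf{RI}}_{A\wedge B}=\wedge\mathsf{R}(\wedge\mathsf{L}_1^{\mathsf{RI}}\mathsf{ax}^{\mathsf{RI}}_A,\wedge\mathsf{L}_2^{\mathsf{RI}}\mathsf{ax}^{\mathsf{RI}}_B)$; $\mathsf{ax}^{\mathsf{RI}}_{A\vee B}=\vee\mathsf{L}^{\mathsf{RI}}(\vee\mathsf{R}_1^{\mathsf{RI}}\mathsf{ax}^{\mathsf{RI}}_A,\vee\mathsf{R}_2^{\mathsf{RI}}\mathsf{ax}^{\mathsf{RI}}_B)$. - Right non-invertible rules. Every untagged derivation $f:S\mid\Gamma\vdash_{\mathsf{RI}}A$ consists of a tree of $\wedge\mathsf{R}$'s decomposing all outermost conjunctions of $A$, with leaves $\mathsf{LI2RI}\,f_1,\dots,\mathsf{LI2RI}\,f_n$ (left to right), $f_i:S\mid\Gamma\vdash_{\mathsf{LI}}P_i$; put $\mathsf{inv}(f)=[f_1,\dots,f_n]$. Then $\vee\mathsf{R}_k^{\mathsf{RI}}f=\mathsf{LI2RI}(\vee\mathsf{R}_k^{\mathsf{LI}}(\mathsf{inv}(f)))$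 for $k=1,2$ and $\otimes\mathsf{R}^{\mathsf{RI}}(f,g)=\mathsf{LI2RI}(\otimes\mathsf{R}^{\mathsf{LI}}(\mathsf{inv}(f),g))$. Here, for $\rho$ one of $\vee\mathsf{R}_1,\vee\mathsf{R}_2,\otimes\mathsf{R}(-,g)$, the operation $\rho^{\mathsf{LI}}$ on a list $fs=[f_1,\dots,f_n]$ of derivations with common stoup and context is defined recursively: (a) if the stoup is $\mathsf{I}$, or has principal connective $\otimes$, all $f_i$ end with the same left invertible rule $r$ ($\mathsf{IL}$, resp. $\otimes\mathsf{L}$), $f_i=r\,f_i'$, and $\rho^{\mathsf{LI}}(fs)=r(\rho^{\mathsf{LI}}[f_1',\dots,f_n'])$; (b) if the stoup has principal connective $\vee$, $f_i=\vee\mathsf{L}(f_i',f_i'')$ and $\rho^{\mathsf{LI}}(fs)=\vee\mathsf{L}(\rho^{\mathsf{LI}}[f_i']_i,\rho^{\mathsf{LI}}[f_i'']_i)$; (c) if the stoup is irreducible, $f_i=\mathsf{F2LI}\,h_i$ for all $i$; let $t_i$ be $\mathbb{P}$, $\mathbb{C}_1$, $\mathbb{C}_2$ if $h_i$ ends with $\mathsf{pass}$, $\wedge\mathsf{L}_1$, $\wedge\mathsf{L}_2$ respectively, and $\mathbb{R}$ otherwise, and let $l=[t_1,\dots,t_n]$. If $l$ is valid, then $\rho^{\mathsf{LI}}(fs)=\mathsf{F2LI}(\rho(h))$, where $h$ is the tagged derivation in phase $\vdash^l_{\mathsf{RI}}$ obtained from the derivations $\mathsf{LI2RI}(\mathsf{F2LI}\,h_i^{t_i})$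 by applying $\wedge\mathsf{R}$'s according to the conjunctive structure of the succedent, with $h_i^{t_i}$ the version of $h_i$ whose conclusion carries the tag $t_i$. If $l$ is not valid, all $h_i$ end with the same rule $r\in\{\mathsf{pass},\wedge\mathsf{L}_1,\wedge\mathsf{L}_2\}$, $h_i=r\,h_i'$, and $\rho^{\mathsf{LI}}(fs)=\mathsf{F2LI}(r(\rho^{\mathsf{LI}}[h_1',\dots,h_n']))$. -}

module Defs where

open import Data.Empty using (⊥)
open import Data.List using (List; []; _∷_; [_]; _++_)
open import Data.List.Membership.Propositional using (_∈_)
open import Data.List.Membership.Propositional.Properties using (∈-++⁺ˡ; ∈-++⁺ʳ)
open import Data.List.Properties using (≡-dec; ++-conicalˡ; ++-conicalʳ)
open import Data.List.Relation.Unary.Any using (here; any?)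
open import Data.Maybe using (Maybe; just; nothing)
open import Data.Product using (_×_; _,_)
open import Data.Sum using (_⊎_; inj₁; inj₂)
open import Data.Unit using (⊤; tt)
open import Function using (_∘_)
open import Relation.Binary using (DecidableEquality)
open import Relation.Binary.PropositionalEquality using (_≡_; _≢_; refl; sym; subst)
open import Relation.Nullary using (¬_; Dec; yes; no; contradiction)
open import Relation.Nullary.Decidable using (_×-dec_; _⊎-dec_; ¬?)

data Tag : Set where
  ℙ ℂ₁ ℂ₂ ℝ : Tag

Valid : List Tag → Set
Valid l = l ≢ [] × (ℝ ∈ l ⊎ (ℂ₁ ∈ l × ℂ₂ ∈ l))

_≟_ : DecidableEquality Tag
ℙ  ≟ ℙ  = yes refl
ℙ  ≟ ℂ₁ = no λ ()
ℙ  ≟ ℂ₂ = no λ ()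
ℙ  ≟ ℝ  = no λ ()
ℂ₁ ≟ ℙ  = no λ ()
ℂ₁ ≟ ℂ₁ = yes refl
ℂ₁ ≟ ℂ₂ = no λ ()
ℂ₁ ≟ ℝ  = no λ ()
ℂ₂ ≟ ℙ  = no λ ()
ℂ₂ ≟ ℂ₁ = no λ ()
ℂ₂ ≟ ℂ₂ = yes refl
ℂ₂ ≟ ℝ  = no λ ()
ℝ  ≟ ℙ  = no λ ()
ℝ  ≟ ℂ₁ = no λ ()
ℝ  ≟ ℂ₂ = no λ ()
ℝ  ≟ ℝ  = yes refl

valid? : (l : List Tag) → Dec (Valid l)
valid? l = ¬? (≡-dec _≟_ l []) ×-dec ((ℝ ∈? l) ⊎-dec ((ℂ₁ ∈? l) ×-dec (ℂ₂ ∈? l)))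
  where
  _∈?_ : (t : Tag) (l : List Tag) → Dec (t ∈ l)
  t ∈? l = any? (t ≟_) l

valid-++ˡ : ∀ {l₁ l₂} → Valid l₁ → Valid (l₁ ++ l₂)
valid-++ˡ {l₁} {l₂} (ne , inj₁ r) = (ne ∘ ++-conicalˡ l₁ l₂) , inj₁ (∈-++⁺ˡ r)
valid-++ˡ {l₁} {l₂} (ne , inj₂ (c₁ , c₂)) =
  (ne ∘ ++-conicalˡ l₁ l₂) , inj₂ (∈-++⁺ˡ c₁ , ∈-++⁺ˡ c₂)

valid-++ʳ : ∀ {l₁ l₂} → Valid l₂ → Valid (l₁ ++ l₂)
valid-++ʳ {l₁} {l₂} (ne , inj₁ r) = (ne ∘ ++-conicalʳ l₁ l₂) , inj₁ (∈-++⁺ʳ l₁ r)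
valid-++ʳ {l₁} {l₂} (ne , inj₂ (c₁ , c₂)) =
  (ne ∘ ++-conicalʳ l₁ l₂) , inj₂ (∈-++⁺ʳ l₁ c₁ , ∈-++⁺ʳ l₁ c₂)

-- The question marks l? and t? on sequents: a rule with a question mark is
-- a single constructor, polymorphic in the mode m.

data Mode : Set where
  untagged tagged : Mode

Tag? : Mode → Set
Tag? untagged = ⊤
Tag? tagged   = Tag

Tags? : Mode → Set
Tags? untagged = ⊤
Tags? tagged   = List Tag

tag? : (m : Mode) → Tag → Tag? m
tag? untagged _ = tt
tag? tagged   t = t

single? : (m : Mode) → Tag? m → Tags? m
single? untagged _ = tt
single? tagged   t = [ t ]

concat? : (m : Mode) → Tags? m → Tags? m → Tags? m
concat? untagged _  _  = tt
concat? tagged   l₁ l₂ = l₁ ++ l₂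

module Calculus (At : Set) where

  infixr 7 _⊗_
  infixr 6 _∧_ _∨_
  infix  4 _∣_⊢_ _∣_⊢RI_ _∣_⊢LI_ _∣_⊢F_ _∣_⊢RI[_]_ _∣_⊢F[_]_ _≗_

  data Fml : Set where
    `_  : At → Fml
    I   : Fml
    _⊗_ : Fml → Fml → Fml
    _∧_ : Fml → Fml → Fml
    _∨_ : Fml → Fml → Fml

  Stoup : Set
  Stoup = Maybe Fml

  Cxt : Set
  Cxt = List Fml

  variable
    S     : Stoup
    Γ Δ   : Cxt
    A B C : Fml
    X     : At
    m     : Mode

  data _∣_⊢_ : Stoup → Cxt → Fml → Set where
    ax   : just A ∣ [] ⊢ A
    pass : just A ∣ Γ ⊢ C → nothing ∣ A ∷ Γ ⊢ C
    IL   : nothing ∣ Γ ⊢ C → just I ∣ Γ ⊢ C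
    IR   : nothing ∣ [] ⊢ I
    ⊗L   : just A ∣ B ∷ Γ ⊢ C → just (A ⊗ B) ∣ Γ ⊢ C
    ⊗R   : S ∣ Γ ⊢ A → nothing ∣ Δ ⊢ B → S ∣ Γ ++ Δ ⊢ A ⊗ B
    ∧L₁  : just A ∣ Γ ⊢ C → just (A ∧ B) ∣ Γ ⊢ C
    ∧L₂  : just B ∣ Γ ⊢ C → just (A ∧ B) ∣ Γ ⊢ C
    ∧R   : S ∣ Γ ⊢ A → S ∣ Γ ⊢ B → S ∣ Γ ⊢ A ∧ B
    ∨L   : just A ∣ Γ ⊢ C → just B ∣ Γ ⊢ C → just (A ∨ B) ∣ Γ ⊢ C
    ∨R₁  : S ∣ Γ ⊢ A → S ∣ Γ ⊢ A ∨ B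
    ∨R₂  : S ∣ Γ ⊢ B → S ∣ Γ ⊢ A ∨ B

  data _≗_ : S ∣ Γ ⊢ A → S ∣ Γ ⊢ A → Set where
    ≗refl  : {f : S ∣ Γ ⊢ A} → f ≗ f
    ≗sym   : {f g : S ∣ Γ ⊢ A} → f ≗ g → g ≗ f
    ≗trans : {f g h : S ∣ Γ ⊢ A} → f ≗ g → g ≗ h → f ≗ h

    cong-pass : {f g : just A ∣ Γ ⊢ C} → f ≗ g → pass f ≗ pass g
    cong-IL   : {f g : nothing ∣ Γ ⊢ C} → f ≗ g → IL f ≗ IL g
    cong-⊗L   : {f g : just A ∣ B ∷ Γ ⊢ C} → f ≗ g → ⊗L f ≗ ⊗L g
    cong-⊗R   : {f f′ : S ∣ Γ ⊢ A} {g g′ : nothing ∣ Δ ⊢ B} →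
                f ≗ f′ → g ≗ g′ → ⊗R f g ≗ ⊗R f′ g′
    cong-∧L₁  : {f g : just A ∣ Γ ⊢ C} → f ≗ g → ∧L₁ {B = B} f ≗ ∧L₁ g
    cong-∧L₂  : {f g : just B ∣ Γ ⊢ C} → f ≗ g → ∧L₂ {A = A} f ≗ ∧L₂ g
    cong-∧R   : {f f′ : S ∣ Γ ⊢ A} {g g′ : S ∣ Γ ⊢ B} →
                f ≗ f′ → g ≗ g′ → ∧R f g ≗ ∧R f′ g′
    cong-∨L   : {f f′ : just A ∣ Γ ⊢ C} {g g′ : just B ∣ Γ ⊢ C} →
                f ≗ f′ → g ≗ g′ → ∨L f g ≗ ∨L f′ g′
    cong-∨R₁  : {f g : S ∣ Γ ⊢ A} → f ≗ g → ∨R₁ {B = B} f ≗ ∨R₁ g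
    cong-∨R₂  : {f g : S ∣ Γ ⊢ B} → f ≗ g → ∨R₂ {A = A} f ≗ ∨R₂ g

    axI : ax {A = I} ≗ IL IR
    ax⊗ : ax {A = A ⊗ B} ≗ ⊗L (⊗R ax (pass ax))
    ax∧ : ax {A = A ∧ B} ≗ ∧R (∧L₁ ax) (∧L₂ ax)
    ax∨ : ax {A = A ∨ B} ≗ ∨L (∨R₁ ax) (∨R₂ ax)

    ⊗R-pass : {f : just C ∣ Γ ⊢ A} {g : nothing ∣ Δ ⊢ B} →
              ⊗R (pass f) g ≗ pass (⊗R f g)
    ⊗R-IL   : {f : nothing ∣ Γ ⊢ A} {g : nothing ∣ Δ ⊢ B} →
              ⊗R (IL f) g ≗ IL (⊗R f g)
    ⊗R-⊗L   : {A′ B′ : Fml} {f : just A′ ∣ B′ ∷ Γ ⊢ A} {g : nothing ∣ Δ ⊢ B} →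
              ⊗R (⊗L f) g ≗ ⊗L (⊗R f g)
    ⊗R-∧L₁  : {A′ B′ : Fml} {f : just A′ ∣ Γ ⊢ A} {g : nothing ∣ Δ ⊢ B} →
              ⊗R (∧L₁ {B = B′} f) g ≗ ∧L₁ (⊗R f g)
    ⊗R-∧L₂  : {A′ B′ : Fml} {f : just B′ ∣ Γ ⊢ A} {g : nothing ∣ Δ ⊢ B} →
              ⊗R (∧L₂ {A = A′} f) g ≗ ∧L₂ (⊗R f g)
    ⊗R-∨L   : {A′ B′ : Fml} {f₁ : just A′ ∣ Γ ⊢ A} {f₂ : just B′ ∣ Γ ⊢ A}
              {g : nothing ∣ Δ ⊢ B} →
              ⊗R (∨L f₁ f₂) g ≗ ∨L (⊗R f₁ g) (⊗R f₂ g)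

    pass-∧R : {f : just C ∣ Γ ⊢ A} {g : just C ∣ Γ ⊢ B} →
              pass (∧R f g) ≗ ∧R (pass f) (pass g)
    IL-∧R   : {f : nothing ∣ Γ ⊢ A} {g : nothing ∣ Γ ⊢ B} →
              IL (∧R f g) ≗ ∧R (IL f) (IL g)
    ⊗L-∧R   : {A′ B′ : Fml} {f : just A′ ∣ B′ ∷ Γ ⊢ A} {g : just A′ ∣ B′ ∷ Γ ⊢ B} →
              ⊗L (∧R f g) ≗ ∧R (⊗L f) (⊗L g)
    ∧L₁-∧R  : {A′ B′ : Fml} {f : just A′ ∣ Γ ⊢ A} {g : just A′ ∣ Γ ⊢ B} →
              ∧L₁ {B = B′} (∧R f g) ≗ ∧R (∧L₁ f) (∧L₁ g)
    ∧L₂-∧R  : {A′ B′ : Fml} {f : just B′ ∣ Γ ⊢ A} {g : just B′ ∣ Γ ⊢ B} →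
              ∧L₂ {A = A′} (∧R f g) ≗ ∧R (∧L₂ f) (∧L₂ g)
    ∨L-∧R   : {A′ B′ : Fml} {f₁ : just A′ ∣ Γ ⊢ A} {g₁ : just A′ ∣ Γ ⊢ B}
              {f₂ : just B′ ∣ Γ ⊢ A} {g₂ : just B′ ∣ Γ ⊢ B} →
              ∨L (∧R f₁ g₁) (∧R f₂ g₂) ≗ ∧R (∨L f₁ f₂) (∨L g₁ g₂)

    ∨R₁-pass : {f : just C ∣ Γ ⊢ A} → ∨R₁ {B = B} (pass f) ≗ pass (∨R₁ f)
    ∨R₁-IL   : {f : nothing ∣ Γ ⊢ A} → ∨R₁ {B = B} (IL f) ≗ IL (∨R₁ f)
    ∨R₁-⊗L   : {A′ B′ : Fml} {f : just A′ ∣ B′ ∷ Γ ⊢ A} →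
               ∨R₁ {B = B} (⊗L f) ≗ ⊗L (∨R₁ f)
    ∨R₁-∧L₁  : {A′ B′ : Fml} {f : just A′ ∣ Γ ⊢ A} →
               ∨R₁ {B = B} (∧L₁ {B = B′} f) ≗ ∧L₁ (∨R₁ f)
    ∨R₁-∧L₂  : {A′ B′ : Fml} {f : just B′ ∣ Γ ⊢ A} →
               ∨R₁ {B = B} (∧L₂ {A = A′} f) ≗ ∧L₂ (∨R₁ f)
    ∨R₁-∨L   : {A′ B′ : Fml} {f : just A′ ∣ Γ ⊢ A} {g : just B′ ∣ Γ ⊢ A} →
               ∨R₁ {B = B} (∨L f g) ≗ ∨L (∨R₁ f) (∨R₁ g)

    ∨R₂-pass : {f : just C ∣ Γ ⊢ B} → ∨R₂ {A = A} (pass f) ≗ pass (∨R₂ f)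
    ∨R₂-IL   : {f : nothing ∣ Γ ⊢ B} → ∨R₂ {A = A} (IL f) ≗ IL (∨R₂ f)
    ∨R₂-⊗L   : {A′ B′ : Fml} {f : just A′ ∣ B′ ∷ Γ ⊢ B} →
               ∨R₂ {A = A} (⊗L f) ≗ ⊗L (∨R₂ f)
    ∨R₂-∧L₁  : {A′ B′ : Fml} {f : just A′ ∣ Γ ⊢ B} →
               ∨R₂ {A = A} (∧L₁ {B = B′} f) ≗ ∧L₁ (∨R₂ f)
    ∨R₂-∧L₂  : {A′ B′ : Fml} {f : just B′ ∣ Γ ⊢ B} →
               ∨R₂ {A = A} (∧L₂ {A = A′} f) ≗ ∧L₂ (∨R₂ f)
    ∨R₂-∨L   : {A′ B′ : Fml} {f : just A′ ∣ Γ ⊢ B} {g : just B′ ∣ Γ ⊢ B} →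
               ∨R₂ {A = A} (∨L f g) ≗ ∨L (∨R₂ f) (∨R₂ g)

  NonNegative : Fml → Set
  NonNegative (_ ∧ _) = ⊥
  NonNegative _       = ⊤

  Irreducible : Stoup → Set
  Irreducible (just I)       = ⊥
  Irreducible (just (_ ⊗ _)) = ⊥
  Irreducible (just (_ ∨ _)) = ⊥
  Irreducible _              = ⊤

  record NonNegFml : Set where
    constructor nonNeg
    field
      fml          : Fml
      .nonNegative : NonNegative fml
  open NonNegFml public using (fml)

  record IrrStoup : Set where
    constructor irr
    field
      stoup        : Stoup
      .irreducible : Irreducible stoup
  open IrrStoup public using (stoup)

  variable
    P : NonNegFml
    T : IrrStoup

  data RI : (m : Mode) → Tags? m → Stoup → Cxt → Fml → Set
  data LI : (m : Mode) → Tag? m → Stoup → Cxt → NonNegFml → Set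
  data F  : (m : Mode) → Tag? m → IrrStoup → Cxt → NonNegFml → Set

  _∣_⊢RI_ : Stoup → Cxt → Fml → Set
  S ∣ Γ ⊢RI A = RI untagged tt S Γ A

  _∣_⊢LI_ : Stoup → Cxt → NonNegFml → Set
  S ∣ Γ ⊢LI P = LI untagged tt S Γ P

  _∣_⊢F_ : IrrStoup → Cxt → NonNegFml → Set
  T ∣ Γ ⊢F P = F untagged tt T Γ P

  _∣_⊢RI[_]_ : Stoup → Cxt → List Tag → Fml → Set
  S ∣ Γ ⊢RI[ l ] A = RI tagged l S Γ A

  _∣_⊢F[_]_ : IrrStoup → Cxt → Tag → NonNegFml → Set
  T ∣ Γ ⊢F[ t ] P = F tagged t T Γ P

  -- Side conditions are irrelevant, so ≡ compares derivations only.

  data RI where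
    ∧R    : {l₁ l₂ : Tags? m} → RI m l₁ S Γ A → RI m l₂ S Γ B →
            RI m (concat? m l₁ l₂) S Γ (A ∧ B)
    LI2RI : {t : Tag? m} → LI m t S Γ P → RI m (single? m t) S Γ (fml P)

  data LI where
    IL   : nothing ∣ Γ ⊢LI P → just I ∣ Γ ⊢LI P
    ⊗L   : just A ∣ B ∷ Γ ⊢LI P → just (A ⊗ B) ∣ Γ ⊢LI P
    ∨L   : just A ∣ Γ ⊢LI P → just B ∣ Γ ⊢LI P → just (A ∨ B) ∣ Γ ⊢LI P
    F2LI : {t : Tag? m} → F m t T Γ P → LI m t (stoup T) Γ P

  data F where
    pass : just A ∣ Γ ⊢LI P → F m (tag? m ℙ) (irr nothing tt) (A ∷ Γ) P
    ax   : F m (tag? m ℝ) (irr (just (` X)) tt) [] (nonNeg (` X) tt)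
    IR   : F m (tag? m ℝ) (irr nothing tt) [] (nonNeg I tt)
    ⊗R   : {l : List Tag} → stoup T ∣ Γ ⊢RI[ l ] A → nothing ∣ Δ ⊢RI B → .(Valid l) →
           F m (tag? m ℝ) T (Γ ++ Δ) (nonNeg (A ⊗ B) tt)
    ∨R₁  : {l : List Tag} → stoup T ∣ Γ ⊢RI[ l ] A → .(Valid l) →
           F m (tag? m ℝ) T Γ (nonNeg (A ∨ B) tt)
    ∨R₂  : {l : List Tag} → stoup T ∣ Γ ⊢RI[ l ] B → .(Valid l) →
           F m (tag? m ℝ) T Γ (nonNeg (A ∨ B) tt)
    ∧L₁  : just A ∣ Γ ⊢LI P → F m (tag? m ℂ₁) (irr (just (A ∧ B)) tt) Γ P
    ∧L₂  : just B ∣ Γ ⊢LI P → F m (tag? m ℂ₂) (irr (just (A ∧ B)) tt) Γ P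

  embRI : {l : Tags? m} → RI m l S Γ A → S ∣ Γ ⊢ A
  embLI : {t : Tag? m} → LI m t S Γ P → S ∣ Γ ⊢ fml P
  embF  : {t : Tag? m} → F m t T Γ P → stoup T ∣ Γ ⊢ fml P

  embRI (∧R f g)  = ∧R (embRI f) (embRI g)
  embRI (LI2RI f) = embLI f

  embLI (IL f)   = IL (embLI f)
  embLI (⊗L f)   = ⊗L (embLI f)
  embLI (∨L f g) = ∨L (embLI f) (embLI g)
  embLI (F2LI f) = embF f

  embF (pass f)   = pass (embLI f)
  embF ax         = ax
  embF IR         = IR
  embF (⊗R f g _) = ⊗R (embRI f) (embRI g)
  embF (∨R₁ f _)  = ∨R₁ (embRI f)
  embF (∨R₂ f _)  = ∨R₂ (embRI f)
  embF (∧L₁ f)    = ∧L₁ (embLI f)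
  embF (∧L₂ f)    = ∧L₂ (embLI f)

  passRI : just A ∣ Γ ⊢RI C → nothing ∣ A ∷ Γ ⊢RI C
  passRI (∧R f g)  = ∧R (passRI f) (passRI g)
  passRI (LI2RI f) = LI2RI (F2LI (pass f))

  ILRI : nothing ∣ Γ ⊢RI C → just I ∣ Γ ⊢RI C
  ILRI (∧R f g)  = ∧R (ILRI f) (ILRI g)
  ILRI (LI2RI f) = LI2RI (IL f)

  ⊗LRI : just A ∣ B ∷ Γ ⊢RI C → just (A ⊗ B) ∣ Γ ⊢RI C
  ⊗LRI (∧R f g)  = ∧R (⊗LRI f) (⊗LRI g)
  ⊗LRI (LI2RI f) = LI2RI (⊗L f)

  ∧L₁RI : just A ∣ Γ ⊢RI C → just (A ∧ B) ∣ Γ ⊢RI C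
  ∧L₁RI (∧R f g)  = ∧R (∧L₁RI f) (∧L₁RI g)
  ∧L₁RI (LI2RI f) = LI2RI (F2LI (∧L₁ f))

  ∧L₂RI : just B ∣ Γ ⊢RI C → just (A ∧ B) ∣ Γ ⊢RI C
  ∧L₂RI (∧R f g)  = ∧R (∧L₂RI f) (∧L₂RI g)
  ∧L₂RI (LI2RI f) = LI2RI (F2LI (∧L₂ f))

  ∨LRI : just A ∣ Γ ⊢RI C → just B ∣ Γ ⊢RI C → just (A ∨ B) ∣ Γ ⊢RI C
  ∨LRI (∧R f₁ g₁) (∧R f₂ g₂) = ∧R (∨LRI f₁ f₂) (∨LRI g₁ g₂)
  ∨LRI (LI2RI f)  (LI2RI g)  = LI2RI (∨L f g)
  ∨LRI (∧R _ _) (LI2RI {P = nonNeg _ ()} _)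
  ∨LRI (LI2RI {P = nonNeg _ ()} _) (∧R _ _)

  IRRI : nothing ∣ [] ⊢RI I
  IRRI = LI2RI (F2LI IR)

  -- A list q₁ … qₙ with qᵢ : Q Pᵢ, where P₁ … Pₙ are the conjuncts of A from
  -- left to right.  The list is bracketed like A, from which ∧R's can be rebuilt.

  data Leaves (Q : NonNegFml → Set) : Fml → Set where
    leaf : Q P → Leaves Q (fml P)
    node : Leaves Q A → Leaves Q B → Leaves Q (A ∧ B)

  mapLeaves : {Q R : NonNegFml → Set} → (∀ {P} → Q P → R P) → Leaves Q A → Leaves R A
  mapLeaves k (leaf q)     = leaf (k q)
  mapLeaves k (node qs rs) = node (mapLeaves k qs) (mapLeaves k rs)

  inv : S ∣ Γ ⊢RI A → Leaves (S ∣ Γ ⊢LI_) A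
  inv (∧R f g)  = node (inv f) (inv g)
  inv (LI2RI f) = leaf f

  tagOf : T ∣ Γ ⊢F P → Tag
  tagOf (pass _)   = ℙ
  tagOf ax         = ℝ
  tagOf IR         = ℝ
  tagOf (⊗R _ _ _) = ℝ
  tagOf (∨R₁ _ _)  = ℝ
  tagOf (∨R₂ _ _)  = ℝ
  tagOf (∧L₁ _)    = ℂ₁
  tagOf (∧L₂ _)    = ℂ₂

  withTag : (h : T ∣ Γ ⊢F P) → T ∣ Γ ⊢F[ tagOf h ] P
  withTag (pass f)   = pass f
  withTag ax         = ax
  withTag IR         = IR
  withTag (⊗R f g v) = ⊗R f g v
  withTag (∨R₁ f v)  = ∨R₁ f v
  withTag (∨R₂ f v)  = ∨R₂ f v
  withTag (∧L₁ f)    = ∧L₁ f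
  withTag (∧L₂ f)    = ∧L₂ f

  tags : Leaves (T ∣ Γ ⊢F_) A → List Tag
  tags (leaf h)     = [ tagOf h ]
  tags (node hs ks) = tags hs ++ tags ks

  build : (hs : Leaves (T ∣ Γ ⊢F_) A) → stoup T ∣ Γ ⊢RI[ tags hs ] A
  build (leaf h)     = LI2RI (F2LI (withTag h))
  build (node hs ks) = ∧R (build hs) (build ks)

  data SameRule : Leaves (T ∣ Γ ⊢F_) A → Set where
    all-pass : (fs : Leaves (just B ∣ Γ ⊢LI_) A) → SameRule (mapLeaves pass fs)
    all-∧L₁  : (fs : Leaves (just B ∣ Γ ⊢LI_) A) → SameRule (mapLeaves (∧L₁ {B = C}) fs)
    all-∧L₂  : (fs : Leaves (just C ∣ Γ ⊢LI_) A) → SameRule (mapLeaves (∧L₂ {A = B}) fs)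

  ℂ₁∈tags : (fs : Leaves (just B ∣ Γ ⊢LI_) A) → ℂ₁ ∈ tags (mapLeaves (∧L₁ {B = C}) fs)
  ℂ₁∈tags (leaf _)    = here refl
  ℂ₁∈tags (node fs _) = ∈-++⁺ˡ (ℂ₁∈tags fs)

  ℂ₂∈tags : (fs : Leaves (just C ∣ Γ ⊢LI_) A) → ℂ₂ ∈ tags (mapLeaves (∧L₂ {A = B}) fs)
  ℂ₂∈tags (leaf _)    = here refl
  ℂ₂∈tags (node fs _) = ∈-++⁺ˡ (ℂ₂∈tags fs)

  ∈⇒≢[] : {t : Tag} {l : List Tag} → t ∈ l → l ≢ []
  ∈⇒≢[] () refl

  ℂ-valid : {l : List Tag} → ℂ₁ ∈ l → ℂ₂ ∈ l → Valid l
  ℂ-valid c₁ c₂ = ∈⇒≢[] c₁ , inj₂ (c₁ , c₂)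

  [ℝ]-valid : Valid [ ℝ ]
  [ℝ]-valid = (λ ()) , inj₁ (here refl)

  sameRule : (hs : Leaves (T ∣ Γ ⊢F_) A) → ¬ Valid (tags hs) → SameRule hs
  sameRule (leaf (pass f))   ¬v = all-pass (leaf f)
  sameRule (leaf ax)         ¬v = contradiction [ℝ]-valid ¬v
  sameRule (leaf IR)         ¬v = contradiction [ℝ]-valid ¬v
  sameRule (leaf (⊗R _ _ _)) ¬v = contradiction [ℝ]-valid ¬v
  sameRule (leaf (∨R₁ _ _))  ¬v = contradiction [ℝ]-valid ¬v
  sameRule (leaf (∨R₂ _ _))  ¬v = contradiction [ℝ]-valid ¬v
  sameRule (leaf (∧L₁ f))    ¬v = all-∧L₁ (leaf f)
  sameRule (leaf (∧L₂ f))    ¬v = all-∧L₂ (leaf f)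
  sameRule (node hs ks) ¬v
    with sameRule hs (¬v ∘ valid-++ˡ) | sameRule ks (¬v ∘ valid-++ʳ {tags hs})
  ... | all-pass fs | all-pass gs = all-pass (node fs gs)
  ... | all-∧L₁ fs  | all-∧L₁ gs  = all-∧L₁ (node fs gs)
  ... | all-∧L₂ fs  | all-∧L₂ gs  = all-∧L₂ (node fs gs)
  ... | all-∧L₁ fs  | all-∧L₂ gs  =
    contradiction (ℂ-valid (∈-++⁺ˡ (ℂ₁∈tags fs)) (∈-++⁺ʳ _ (ℂ₂∈tags gs))) ¬v
  ... | all-∧L₂ fs  | all-∧L₁ gs  =
    contradiction (ℂ-valid (∈-++⁺ʳ _ (ℂ₁∈tags gs))
                           (∈-++⁺ˡ (ℂ₂∈tags fs))) ¬v

  unIL : just I ∣ Γ ⊢LI P → nothing ∣ Γ ⊢LI P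
  unIL (IL f) = f
  unIL (F2LI {T = irr _ ()} _)

  un⊗L : just (A ⊗ B) ∣ Γ ⊢LI P → just A ∣ B ∷ Γ ⊢LI P
  un⊗L (⊗L f) = f
  un⊗L (F2LI {T = irr _ ()} _)

  un∨L₁ : just (A ∨ B) ∣ Γ ⊢LI P → just A ∣ Γ ⊢LI P
  un∨L₁ (∨L f _) = f
  un∨L₁ (F2LI {T = irr _ ()} _)

  un∨L₂ : just (A ∨ B) ∣ Γ ⊢LI P → just B ∣ Γ ⊢LI P
  un∨L₂ (∨L _ g) = g
  un∨L₂ (F2LI {T = irr _ ()} _)

  unF2LI : (T : IrrStoup) → stoup T ∣ Γ ⊢LI P → T ∣ Γ ⊢F P
  unF2LI (irr nothing _)        (F2LI h) = h
  unF2LI (irr (just (` _)) _)   (F2LI h) = h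
  unF2LI (irr (just (_ ∧ _)) _) (F2LI h) = h
  unF2LI (irr (just I) ())
  unF2LI (irr (just (_ ⊗ _)) ())
  unF2LI (irr (just (_ ∨ _)) ())

  -- Rules that still await their left premise, in which A is the succedent.

  data RightRule (A : Fml) : Set where
    ∨R₁ ∨R₂ : Fml → RightRule A
    ⊗R      : nothing ∣ Δ ⊢RI B → RightRule A

  cxt : RightRule A → Cxt → Cxt
  cxt (∨R₁ _)        Γ = Γ
  cxt (∨R₂ _)        Γ = Γ
  cxt (⊗R {Δ = Δ} _) Γ = Γ ++ Δ

  cxt-∷ : (ρ : RightRule A) → cxt ρ (B ∷ Γ) ≡ B ∷ cxt ρ Γ
  cxt-∷ (∨R₁ _) = refl
  cxt-∷ (∨R₂ _) = refl
  cxt-∷ (⊗R _)  = refl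

  concl : RightRule A → NonNegFml
  concl {A = A} (∨R₁ B)        = nonNeg (A ∨ B) tt
  concl {A = B} (∨R₂ A)        = nonNeg (A ∨ B) tt
  concl {A = A} (⊗R {B = B} _) = nonNeg (A ⊗ B) tt

  apply : (ρ : RightRule A) {l : List Tag} → stoup T ∣ Γ ⊢RI[ l ] A → .(Valid l) →
          T ∣ cxt ρ Γ ⊢F concl ρ
  apply (∨R₁ _) f v = ∨R₁ f v
  apply (∨R₂ _) f v = ∨R₂ f v
  apply (⊗R g)  f v = ⊗R f g v

  -- The left-hand sides met on decomposing S ∣ Γ bottom-up.  This is only a
  -- termination measure: it has exactly one inhabitant for each S and Γ.

  data Decomp : Stoup → Cxt → Set where
    empty : Decomp nothing []
    pass  : Decomp (just A) Γ → Decomp nothing (A ∷ Γ)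
    atom  : Decomp (just (` X)) Γ
    IL    : Decomp nothing Γ → Decomp (just I) Γ
    ⊗L    : Decomp (just A) (B ∷ Γ) → Decomp (just (A ⊗ B)) Γ
    ∧L    : Decomp (just A) Γ → Decomp (just B) Γ → Decomp (just (A ∧ B)) Γ
    ∨L    : Decomp (just A) Γ → Decomp (just B) Γ → Decomp (just (A ∨ B)) Γ

  decompFml : (A : Fml) → Decomp nothing Γ → Decomp (just A) Γ
  decompFml (` _)   d = atom
  decompFml I       d = IL d
  decompFml (A ⊗ B) d = ⊗L (decompFml A (pass (decompFml B d)))
  decompFml (A ∧ B) d = ∧L (decompFml A d) (decompFml B d)
  decompFml (A ∨ B) d = ∨L (decompFml A d) (decompFml B d)

  decompCxt : (Γ : Cxt) → Decomp nothing Γ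
  decompCxt []      = empty
  decompCxt (A ∷ Γ) = pass (decompFml A (decompCxt Γ))

  decomp : (S : Stoup) (Γ : Cxt) → Decomp S Γ
  decomp nothing  Γ = decompCxt Γ
  decomp (just A) Γ = decompFml A (decompCxt Γ)

  module _ (ρ : RightRule A) where

    rightLI  : Decomp S Γ → Leaves (S ∣ Γ ⊢LI_) A → S ∣ cxt ρ Γ ⊢LI concl ρ
    rightIrr : Decomp (stoup T) Γ → Leaves (T ∣ Γ ⊢F_) A →
               stoup T ∣ cxt ρ Γ ⊢LI concl ρ
    same     : Decomp (stoup T) Γ → {hs : Leaves (T ∣ Γ ⊢F_) A} → SameRule hs →
               T ∣ cxt ρ Γ ⊢F concl ρ

    rightLI (IL d)      fs = IL (rightLI d (mapLeaves unIL fs))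
    rightLI (⊗L d)      fs =
      ⊗L (subst (_ ∣_⊢LI _) (cxt-∷ ρ) (rightLI d (mapLeaves un⊗L fs)))
    rightLI (∨L d₁ d₂)  fs =
      ∨L (rightLI d₁ (mapLeaves un∨L₁ fs)) (rightLI d₂ (mapLeaves un∨L₂ fs))
    rightLI d@empty     fs = rightIrr d (mapLeaves (unF2LI (irr _ tt)) fs)
    rightLI d@(pass _)  fs = rightIrr d (mapLeaves (unF2LI (irr _ tt)) fs)
    rightLI d@atom      fs = rightIrr d (mapLeaves (unF2LI (irr _ tt)) fs)
    rightLI d@(∧L _ _)  fs = rightIrr d (mapLeaves (unF2LI (irr _ tt)) fs)

    rightIrr {T = T} d hs with valid? (tags hs)
    ... | yes v = F2LI {T = T} (apply ρ (build hs) v)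
    ... | no ¬v = F2LI {T = T} (same d (sameRule hs ¬v))

    same (pass d)  (all-pass fs) =
      subst (_ ∣_⊢F _) (sym (cxt-∷ ρ)) (pass (rightLI d fs))
    same (∧L d _)  (all-∧L₁ fs)  = ∧L₁ (rightLI d fs)
    same (∧L _ d)  (all-∧L₂ fs)  = ∧L₂ (rightLI d fs)

  rightRI : (ρ : RightRule A) → S ∣ Γ ⊢RI A → S ∣ cxt ρ Γ ⊢RI fml (concl ρ)
  rightRI {S = S} {Γ = Γ} ρ f = LI2RI (rightLI ρ (decomp S Γ) (inv f))

  ∨R₁RI : S ∣ Γ ⊢RI A → S ∣ Γ ⊢RI A ∨ B
  ∨R₁RI = rightRI (∨R₁ _)

  ∨R₂RI : S ∣ Γ ⊢RI B → S ∣ Γ ⊢RI A ∨ B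
  ∨R₂RI = rightRI (∨R₂ _)

  ⊗RRI : S ∣ Γ ⊢RI A → nothing ∣ Δ ⊢RI B → S ∣ Γ ++ Δ ⊢RI A ⊗ B
  ⊗RRI f g = rightRI (⊗R g) f

  axRI : (A : Fml) → just A ∣ [] ⊢RI A
  axRI (` _)   = LI2RI (F2LI ax)
  axRI I       = ILRI IRRI
  axRI (A ⊗ B) = ⊗LRI (⊗RRI (axRI A) (passRI (axRI B)))
  axRI (A ∧ B) = ∧R (∧L₁RI (axRI A)) (∧L₂RI (axRI B))
  axRI (A ∨ B) = ∨LRI (∨R₁RI (axRI A)) (∨R₂RI (axRI B))

  focus : S ∣ Γ ⊢ A → S ∣ Γ ⊢RI A
  focus ax        = axRI _
  focus (pass f)  = passRI (focus f)
  focus (IL f)    = ILRI (focus f)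
  focus IR        = IRRI
  focus (⊗L f)    = ⊗LRI (focus f)
  focus (⊗R f g)  = ⊗RRI (focus f) (focus g)
  focus (∧L₁ f)   = ∧L₁RI (focus f)
  focus (∧L₂ f)   = ∧L₂RI (focus f)
  focus (∧R f g)  = ∧R (focus f) (focus g)
  focus (∨L f g)  = ∨LRI (focus f) (focus g)
  focus (∨R₁ f)   = ∨R₁RI (focus f)
  focus (∨R₂ f)   = ∨R₂RI (focus f)

{-# OPTIONS --safe #-}

-- Everything rests on computing ρ^LI on the leaves of its premise: it pulls a
-- left rule shared by all leaves below ρ, and stops exactly when the tags are
-- valid.  On leaves that all end with the same non-invertible left rule this
-- yields the permutations of ≗, since their tags are then constant, hence not
-- valid.  A tagged premise is always rebuilt from its leaves, so a valid one is
-- returned unchanged, which makes focus invert emb.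

module Submission where

open import Defs
open import Data.List using (List; _∷_)
open import Data.List.Membership.Propositional using (_∈_)
open import Data.List.Membership.Propositional.Properties using (∈-++⁻)
open import Data.List.Relation.Unary.Any using (here)
open import Data.Maybe using (just; nothing)
open import Data.Product using (_×_; _,_)
open import Data.Sum using (inj₁; inj₂)
open import Data.Unit using (tt)
open import Function using (_∘_)
open import Relation.Binary.PropositionalEquality
  using (_≡_; _≢_; refl; sym; trans; cong; cong₂; subst)
open import Relation.Nullary using (¬_; yes; no; contradiction; contradiction-irr)

module _ {At : Set} where

  open Calculus At

  -- Leaves of derivations built by the left operations.

  ≡⇒≗ : {f g : S ∣ Γ ⊢ A} → f ≡ g → f ≗ g
  ≡⇒≗ refl = ≗refl

  mapLeaves-∘ : {Q R U : NonNegFml → Set} {k : ∀ {P} → R P → U P} {j : ∀ {P} → Q P → R P}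
                (qs : Leaves Q A) → mapLeaves k (mapLeaves j qs) ≡ mapLeaves (λ q → k (j q)) qs
  mapLeaves-∘ (leaf q)     = refl
  mapLeaves-∘ (node qs rs) = cong₂ node (mapLeaves-∘ qs) (mapLeaves-∘ rs)

  mapLeaves-id : {Q : NonNegFml → Set} {k : ∀ {P} → Q P → Q P} →
                 (∀ {P} (q : Q P) → k q ≡ q) → (qs : Leaves Q A) → mapLeaves k qs ≡ qs
  mapLeaves-id eq (leaf q)     = cong leaf (eq q)
  mapLeaves-id eq (node qs rs) = cong₂ node (mapLeaves-id eq qs) (mapLeaves-id eq rs)

  -- Two separate maps, because the inner one is the index of `all-pass` and the outer one is what
  -- `rightLI-same` removes. The versions for `∧L₁RI` and `∧L₂RI` have this form for the same
  -- reason.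
  inv-passRI : (f : just B ∣ Γ ⊢RI A) →
               inv (passRI f) ≡ mapLeaves (λ h → F2LI h) (mapLeaves (λ f → pass f) (inv f))
  inv-passRI (∧R f g)  = cong₂ node (inv-passRI f) (inv-passRI g)
  inv-passRI (LI2RI f) = refl

  inv-∧L₁RI : (f : just B ∣ Γ ⊢RI A) →
              inv (∧L₁RI {B = C} f) ≡ mapLeaves (λ h → F2LI h) (mapLeaves (λ f → ∧L₁ f) (inv f))
  inv-∧L₁RI (∧R f g)  = cong₂ node (inv-∧L₁RI f) (inv-∧L₁RI g)
  inv-∧L₁RI (LI2RI f) = refl

  inv-∧L₂RI : (f : just B ∣ Γ ⊢RI A) →
              inv (∧L₂RI {A = C} f) ≡ mapLeaves (λ h → F2LI h) (mapLeaves (λ f → ∧L₂ f) (inv f))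
  inv-∧L₂RI (∧R f g)  = cong₂ node (inv-∧L₂RI f) (inv-∧L₂RI g)
  inv-∧L₂RI (LI2RI f) = refl

  -- Invertible rules are handled through their inverses, since `rightLI` at `IL d` starts by
  -- mapping `unIL` over the leaves.
  inv-ILRI : (f : nothing ∣ Γ ⊢RI A) → mapLeaves unIL (inv (ILRI f)) ≡ inv f
  inv-ILRI (∧R f g)  = cong₂ node (inv-ILRI f) (inv-ILRI g)
  inv-ILRI (LI2RI f) = refl

  inv-⊗LRI : (f : just A ∣ B ∷ Γ ⊢RI C) → mapLeaves un⊗L (inv (⊗LRI f)) ≡ inv f
  inv-⊗LRI (∧R f g)  = cong₂ node (inv-⊗LRI f) (inv-⊗LRI g)
  inv-⊗LRI (LI2RI f) = refl

  inv-∨LRI₁ : (f : just A ∣ Γ ⊢RI C) (g : just B ∣ Γ ⊢RI C) →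
              mapLeaves un∨L₁ (inv (∨LRI f g)) ≡ inv f
  inv-∨LRI₁ (∧R f₁ g₁) (∧R f₂ g₂) = cong₂ node (inv-∨LRI₁ f₁ f₂) (inv-∨LRI₁ g₁ g₂)
  inv-∨LRI₁ (LI2RI f)  (LI2RI g)  = refl
  -- Both premises have succedent `C`; here `LI2RI` would make a conjunction non-negative.
  inv-∨LRI₁ (∧R _ _) (LI2RI {P = nonNeg _ ()} _)
  inv-∨LRI₁ (LI2RI {P = nonNeg _ ()} _) (∧R _ _)

  inv-∨LRI₂ : (f : just A ∣ Γ ⊢RI C) (g : just B ∣ Γ ⊢RI C) →
              mapLeaves un∨L₂ (inv (∨LRI f g)) ≡ inv g
  inv-∨LRI₂ (∧R f₁ g₁) (∧R f₂ g₂) = cong₂ node (inv-∨LRI₂ f₁ f₂) (inv-∨LRI₂ g₁ g₂)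
  inv-∨LRI₂ (LI2RI f)  (LI2RI g)  = refl
  inv-∨LRI₂ (∧R _ _) (LI2RI {P = nonNeg _ ()} _)
  inv-∨LRI₂ (LI2RI {P = nonNeg _ ()} _) (∧R _ _)

  -- Tags of leaves that share a left rule.

  tags-mapLeaves : {Q : NonNegFml → Set} {k : ∀ {P} → Q P → T ∣ Γ ⊢F P} {t u : Tag} →
                   (∀ {P} (q : Q P) → tagOf (k q) ≡ t) → (qs : Leaves Q A) →
                   u ∈ tags (mapLeaves k qs) → u ≡ t
  tags-mapLeaves eq (leaf q) (here refl) = eq q
  tags-mapLeaves {k = k} eq (node qs rs) u∈ with ∈-++⁻ (tags (mapLeaves k qs)) u∈
  ... | inj₁ u∈qs = tags-mapLeaves eq qs u∈qs
  ... | inj₂ u∈rs = tags-mapLeaves eq rs u∈rs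

  -- Validity asks for `ℝ` or for two distinct tags, and a constant list other than of `ℝ` offers
  -- neither.
  constant⇒¬valid : {l : List Tag} {t : Tag} → t ≢ ℝ → (∀ {u} → u ∈ l → u ≡ t) → ¬ Valid l
  constant⇒¬valid t≢ℝ all (_ , inj₁ r) = t≢ℝ (sym (all r))
  constant⇒¬valid t≢ℝ all (_ , inj₂ (c₁ , c₂)) with trans (all c₁) (sym (all c₂))
  ... | ()

  -- The converse of `sameRule`: on such leaves the test in `rightIrr` must answer `no`.
  SameRule⇒¬valid : {hs : Leaves (T ∣ Γ ⊢F_) A} → SameRule hs → ¬ Valid (tags hs)
  SameRule⇒¬valid (all-pass fs) = constant⇒¬valid (λ ()) (tags-mapLeaves (λ _ → refl) fs)
  SameRule⇒¬valid (all-∧L₁ fs)  = constant⇒¬valid (λ ()) (tags-mapLeaves (λ _ → refl) fs)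
  SameRule⇒¬valid (all-∧L₂ fs)  = constant⇒¬valid (λ ()) (tags-mapLeaves (λ _ → refl) fs)

  sameRule-pass : (fs : Leaves (just B ∣ Γ ⊢LI_) A) (¬v : ¬ Valid (tags (mapLeaves pass fs))) →
                  sameRule (mapLeaves pass fs) ¬v ≡ all-pass fs
  sameRule-pass (leaf f)     ¬v = refl
  sameRule-pass (node fs gs) ¬v
    -- These are the very calls scrutinised by `sameRule`, with the same refutations, so its `with`
    -- reduces to the `all-pass` clause.
    rewrite sameRule-pass fs (¬v ∘ valid-++ˡ)
          | sameRule-pass gs (¬v ∘ valid-++ʳ {tags (mapLeaves pass fs)}) = refl

  sameRule-∧L₁ : (fs : Leaves (just B ∣ Γ ⊢LI_) A)
                 (¬v : ¬ Valid (tags (mapLeaves (∧L₁ {B = C}) fs))) →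
                 sameRule (mapLeaves (∧L₁ {B = C}) fs) ¬v ≡ all-∧L₁ fs
  sameRule-∧L₁ (leaf f) ¬v = refl
  sameRule-∧L₁ {C = C} (node fs gs) ¬v
    rewrite sameRule-∧L₁ fs (¬v ∘ valid-++ˡ)
          | sameRule-∧L₁ gs (¬v ∘ valid-++ʳ {tags (mapLeaves (∧L₁ {B = C}) fs)}) = refl

  sameRule-∧L₂ : (fs : Leaves (just B ∣ Γ ⊢LI_) A)
                 (¬v : ¬ Valid (tags (mapLeaves (∧L₂ {A = C}) fs))) →
                 sameRule (mapLeaves (∧L₂ {A = C}) fs) ¬v ≡ all-∧L₂ fs
  sameRule-∧L₂ (leaf f) ¬v = refl
  sameRule-∧L₂ {C = C} (node fs gs) ¬v
    rewrite sameRule-∧L₂ fs (¬v ∘ valid-++ˡ)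
          | sameRule-∧L₂ gs (¬v ∘ valid-++ʳ {tags (mapLeaves (∧L₂ {A = C}) fs)}) = refl

  -- `rightIrr` hands `same` the evidence found by `sameRule`; this replaces it by evidence in
  -- constructor form, on which `same` computes. Splitting on `s` turns `hs` into a `mapLeaves`,
  -- over whose argument the induction runs.
  sameRule-unique : {hs : Leaves (T ∣ Γ ⊢F_) A} (s : SameRule hs) (¬v : ¬ Valid (tags hs)) →
                    sameRule hs ¬v ≡ s
  sameRule-unique (all-pass fs) = sameRule-pass fs
  sameRule-unique (all-∧L₁ fs)  = sameRule-∧L₁ fs
  sameRule-unique (all-∧L₂ fs)  = sameRule-∧L₂ fs

  -- Right operations applied below a left rule.

  module _ (ρ : RightRule A) where

    -- T is often given explicitly: unification with stoup T leaves its irrelevant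
    -- component undetermined.

    rightIrr-valid : (d : Decomp (stoup T) Γ) (hs : Leaves (T ∣ Γ ⊢F_) A) .(v : Valid (tags hs)) →
                     rightIrr ρ {T = T} d hs ≡ F2LI {T = T} (apply {T = T} ρ (build {T = T} hs) v)
    rightIrr-valid d hs v with valid? (tags hs)
    -- The validity proof found by the test and `v` fill an irrelevant argument, so the sides agree
    -- definitionally.
    ... | yes _ = refl
    ... | no ¬v = contradiction-irr v ¬v

    rightIrr-same : (d : Decomp (stoup T) Γ) {hs : Leaves (T ∣ Γ ⊢F_) A} (s : SameRule hs) →
                    rightIrr ρ {T = T} d hs ≡ F2LI {T = T} (same ρ {T = T} d s)
    rightIrr-same {T = T} d {hs} s with valid? (tags hs)
    ... | yes v = contradiction v (SameRule⇒¬valid s)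
    ... | no ¬v = cong (λ s → F2LI {T = T} (same ρ {T = T} d s)) (sameRule-unique s ¬v)

    -- `rightLI` reaches `rightIrr` only once the constructor of `d` is known, hence one case per
    -- shape; in each, `unF2LI` cancels `F2LI` on every leaf.
    rightLI-F2LI : (T : IrrStoup) (d : Decomp (stoup T) Γ) (hs : Leaves (T ∣ Γ ⊢F_) A) →
                   rightLI ρ d (mapLeaves (λ h → F2LI h) hs) ≡ rightIrr ρ {T = T} d hs
    rightLI-F2LI (irr nothing _)        empty    hs =
      cong (rightIrr ρ empty) (trans (mapLeaves-∘ hs) (mapLeaves-id (λ _ → refl) hs))
    rightLI-F2LI (irr nothing _)        (pass d) hs =
      cong (rightIrr ρ (pass d)) (trans (mapLeaves-∘ hs) (mapLeaves-id (λ _ → refl) hs))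
    rightLI-F2LI (irr (just (` _)) _)   atom     hs =
      cong (rightIrr ρ atom) (trans (mapLeaves-∘ hs) (mapLeaves-id (λ _ → refl) hs))
    rightLI-F2LI (irr (just (_ ∧ _)) _) (∧L d e) hs =
      cong (rightIrr ρ (∧L d e)) (trans (mapLeaves-∘ hs) (mapLeaves-id (λ _ → refl) hs))

    rightLI-same : (T : IrrStoup) (d : Decomp (stoup T) Γ) {hs : Leaves (T ∣ Γ ⊢F_) A}
                   (s : SameRule hs) →
                   rightLI ρ d (mapLeaves (λ h → F2LI h) hs) ≡ F2LI {T = T} (same ρ {T = T} d s)
    rightLI-same T d s = trans (rightLI-F2LI T d _) (rightIrr-same d s)

    -- For abstract `ρ` the two contexts agree only by `cxt-∷`. Once `ρ` is a constructor the
    -- `subst` vanishes and the right-hand side becomes `passRI (rightRI ρ f)`.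
    rightRI-pass : (f : just B ∣ Γ ⊢RI A) →
                   rightRI ρ (passRI f) ≡
                   LI2RI (F2LI (subst (irr nothing tt ∣_⊢F concl ρ) (sym (cxt-∷ ρ))
                                      (pass (rightLI ρ (decomp (just B) Γ) (inv f)))))
    rightRI-pass {B = B} {Γ = Γ} f =
      cong LI2RI (trans (cong (rightLI ρ (decomp nothing (B ∷ Γ))) (inv-passRI f))
                        (rightLI-same (irr nothing tt) (decomp nothing (B ∷ Γ)) (all-pass (inv f))))

    rightRI-∧L₁ : (f : just B ∣ Γ ⊢RI A) → rightRI ρ (∧L₁RI {B = C} f) ≡ ∧L₁RI (rightRI ρ f)
    rightRI-∧L₁ {B = B} {Γ = Γ} {C = C} f =
      cong LI2RI (trans (cong (rightLI ρ (decomp B∧C Γ)) (inv-∧L₁RI f))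
                        (rightLI-same (irr B∧C tt) (decomp B∧C Γ) (all-∧L₁ (inv f))))
      where
      B∧C = just (B ∧ C)

    rightRI-∧L₂ : (f : just C ∣ Γ ⊢RI A) → rightRI ρ (∧L₂RI {A = B} f) ≡ ∧L₂RI (rightRI ρ f)
    rightRI-∧L₂ {C = C} {Γ = Γ} {B = B} f =
      cong LI2RI (trans (cong (rightLI ρ (decomp B∧C Γ)) (inv-∧L₂RI f))
                        (rightLI-same (irr B∧C tt) (decomp B∧C Γ) (all-∧L₂ (inv f))))
      where
      B∧C = just (B ∧ C)

    rightRI-IL : (f : nothing ∣ Γ ⊢RI A) → rightRI ρ (ILRI f) ≡ ILRI (rightRI ρ f)
    -- `decomp (just I) Γ` reduces to `IL (decomp nothing Γ)`, so the two sides differ only in their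
    -- leaves.
    rightRI-IL {Γ = Γ} f = cong (λ fs → LI2RI (IL (rightLI ρ (decomp nothing Γ) fs))) (inv-ILRI f)

    rightRI-⊗L : (f : just B ∣ C ∷ Γ ⊢RI A) →
                 rightRI ρ (⊗LRI f) ≡
                 LI2RI (⊗L (subst (just _ ∣_⊢LI concl ρ) (cxt-∷ ρ)
                                  (rightLI ρ (decomp (just B) (C ∷ Γ)) (inv f))))
    rightRI-⊗L {B = B} {C = C} {Γ = Γ} f =
      cong (λ fs → LI2RI (⊗L (subst (just _ ∣_⊢LI concl ρ) (cxt-∷ ρ)
                                    (rightLI ρ (decomp (just B) (C ∷ Γ)) fs))))
           (inv-⊗LRI f)

    rightRI-∨L : (f : just B ∣ Γ ⊢RI A) (g : just C ∣ Γ ⊢RI A) →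
                 rightRI ρ (∨LRI f g) ≡ ∨LRI (rightRI ρ f) (rightRI ρ g)
    rightRI-∨L {B = B} {Γ = Γ} {C = C} f g =
      cong₂ (λ fs gs → LI2RI (∨L (rightLI ρ (decomp (just B) Γ) fs) (rightLI ρ (decomp (just C) Γ) gs)))
            (inv-∨LRI₁ f g) (inv-∨LRI₂ f g)

  -- Focusing identifies equivalent derivations.

  focus-resp-≗ : {f g : S ∣ Γ ⊢ A} → f ≗ g → focus f ≡ focus g
  focus-resp-≗ ≗refl           = refl
  focus-resp-≗ (≗sym p)        = sym (focus-resp-≗ p)
  focus-resp-≗ (≗trans p q)    = trans (focus-resp-≗ p) (focus-resp-≗ q)
  focus-resp-≗ (cong-pass p)   = cong passRI (focus-resp-≗ p)
  focus-resp-≗ (cong-IL p)     = cong ILRI (focus-resp-≗ p)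
  focus-resp-≗ (cong-⊗L p)     = cong ⊗LRI (focus-resp-≗ p)
  focus-resp-≗ (cong-⊗R p q)   = cong₂ ⊗RRI (focus-resp-≗ p) (focus-resp-≗ q)
  focus-resp-≗ (cong-∧L₁ p)    = cong ∧L₁RI (focus-resp-≗ p)
  focus-resp-≗ (cong-∧L₂ p)    = cong ∧L₂RI (focus-resp-≗ p)
  focus-resp-≗ (cong-∧R p q)   = cong₂ ∧R (focus-resp-≗ p) (focus-resp-≗ q)
  focus-resp-≗ (cong-∨L p q)   = cong₂ ∨LRI (focus-resp-≗ p) (focus-resp-≗ q)
  focus-resp-≗ (cong-∨R₁ p)    = cong ∨R₁RI (focus-resp-≗ p)
  focus-resp-≗ (cong-∨R₂ p)    = cong ∨R₂RI (focus-resp-≗ p)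
  -- The eta-equations are the defining clauses of `axRI`.
  focus-resp-≗ axI             = refl
  focus-resp-≗ ax⊗             = refl
  focus-resp-≗ ax∧             = refl
  focus-resp-≗ ax∨             = refl
  -- From here each right rule is an instance of `ρ`, with the focused second premise stored inside
  -- it in the case of `⊗R`.
  focus-resp-≗ (⊗R-pass {f = f} {g}) = rightRI-pass (⊗R (focus g)) (focus f)
  focus-resp-≗ (⊗R-IL {f = f} {g})   = rightRI-IL (⊗R (focus g)) (focus f)
  focus-resp-≗ (⊗R-⊗L {f = f} {g})   = rightRI-⊗L (⊗R (focus g)) (focus f)
  focus-resp-≗ (⊗R-∧L₁ {f = f} {g})  = rightRI-∧L₁ (⊗R (focus g)) (focus f)
  focus-resp-≗ (⊗R-∧L₂ {f = f} {g})  = rightRI-∧L₂ (⊗R (focus g)) (focus f)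
  focus-resp-≗ (⊗R-∨L {f₁ = f₁} {f₂} {g}) = rightRI-∨L (⊗R (focus g)) (focus f₁) (focus f₂)
  -- The left operations distribute over `∧R` by definition.
  focus-resp-≗ pass-∧R         = refl
  focus-resp-≗ IL-∧R           = refl
  focus-resp-≗ ⊗L-∧R           = refl
  focus-resp-≗ ∧L₁-∧R          = refl
  focus-resp-≗ ∧L₂-∧R          = refl
  focus-resp-≗ ∨L-∧R           = refl
  focus-resp-≗ (∨R₁-pass {f = f})    = rightRI-pass (∨R₁ _) (focus f)
  focus-resp-≗ (∨R₁-IL {f = f})      = rightRI-IL (∨R₁ _) (focus f)
  focus-resp-≗ (∨R₁-⊗L {f = f})      = rightRI-⊗L (∨R₁ _) (focus f)
  focus-resp-≗ (∨R₁-∧L₁ {f = f})     = rightRI-∧L₁ (∨R₁ _) (focus f)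
  focus-resp-≗ (∨R₁-∧L₂ {f = f})     = rightRI-∧L₂ (∨R₁ _) (focus f)
  focus-resp-≗ (∨R₁-∨L {f = f} {g})  = rightRI-∨L (∨R₁ _) (focus f) (focus g)
  focus-resp-≗ (∨R₂-pass {f = f})    = rightRI-pass (∨R₂ _) (focus f)
  focus-resp-≗ (∨R₂-IL {f = f})      = rightRI-IL (∨R₂ _) (focus f)
  focus-resp-≗ (∨R₂-⊗L {f = f})      = rightRI-⊗L (∨R₂ _) (focus f)
  focus-resp-≗ (∨R₂-∧L₁ {f = f})     = rightRI-∧L₁ (∨R₂ _) (focus f)
  focus-resp-≗ (∨R₂-∧L₂ {f = f})     = rightRI-∧L₂ (∨R₂ _) (focus f)
  focus-resp-≗ (∨R₂-∨L {f = f} {g})  = rightRI-∨L (∨R₂ _) (focus f) (focus g)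

  -- Embedding the left operations.

  -- The operation pushes `pass` up through every `∧R`; `pass-∧R` read backwards pulls it down
  -- again. The other left operations follow the same pattern.
  embRI-passRI : (f : just A ∣ Γ ⊢RI C) → embRI (passRI f) ≗ pass (embRI f)
  embRI-passRI (∧R f g)  = ≗trans (cong-∧R (embRI-passRI f) (embRI-passRI g)) (≗sym pass-∧R)
  embRI-passRI (LI2RI f) = ≗refl

  embRI-ILRI : (f : nothing ∣ Γ ⊢RI C) → embRI (ILRI f) ≗ IL (embRI f)
  embRI-ILRI (∧R f g)  = ≗trans (cong-∧R (embRI-ILRI f) (embRI-ILRI g)) (≗sym IL-∧R)
  embRI-ILRI (LI2RI f) = ≗refl

  embRI-⊗LRI : (f : just A ∣ B ∷ Γ ⊢RI C) → embRI (⊗LRI f) ≗ ⊗L (embRI f)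
  embRI-⊗LRI (∧R f g)  = ≗trans (cong-∧R (embRI-⊗LRI f) (embRI-⊗LRI g)) (≗sym ⊗L-∧R)
  embRI-⊗LRI (LI2RI f) = ≗refl

  embRI-∧L₁RI : (f : just A ∣ Γ ⊢RI C) → embRI (∧L₁RI {B = B} f) ≗ ∧L₁ (embRI f)
  embRI-∧L₁RI (∧R f g)  = ≗trans (cong-∧R (embRI-∧L₁RI f) (embRI-∧L₁RI g)) (≗sym ∧L₁-∧R)
  embRI-∧L₁RI (LI2RI f) = ≗refl

  embRI-∧L₂RI : (f : just B ∣ Γ ⊢RI C) → embRI (∧L₂RI {A = A} f) ≗ ∧L₂ (embRI f)
  embRI-∧L₂RI (∧R f g)  = ≗trans (cong-∧R (embRI-∧L₂RI f) (embRI-∧L₂RI g)) (≗sym ∧L₂-∧R)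
  embRI-∧L₂RI (LI2RI f) = ≗refl

  embRI-∨LRI : (f : just A ∣ Γ ⊢RI C) (g : just B ∣ Γ ⊢RI C) →
               embRI (∨LRI f g) ≗ ∨L (embRI f) (embRI g)
  embRI-∨LRI (∧R f₁ g₁) (∧R f₂ g₂) =
    ≗trans (cong-∧R (embRI-∨LRI f₁ f₂) (embRI-∨LRI g₁ g₂)) (≗sym ∨L-∧R)
  embRI-∨LRI (LI2RI f)  (LI2RI g)  = ≗refl
  embRI-∨LRI (∧R _ _) (LI2RI {P = nonNeg _ ()} _)
  embRI-∨LRI (LI2RI {P = nonNeg _ ()} _) (∧R _ _)

  -- Embedding the right operations.

  -- Generic in `Q`, to serve both the `LI` leaves of `rightLI` and the `F` leaves of `rightIrr`.
  embLeaves : {Q : NonNegFml → Set} → (∀ {P} → Q P → S ∣ Γ ⊢ fml P) → Leaves Q A → S ∣ Γ ⊢ A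
  embLeaves k (leaf q)     = k q
  embLeaves k (node qs rs) = ∧R (embLeaves k qs) (embLeaves k rs)

  embLeaves-inv : (f : S ∣ Γ ⊢RI A) → embLeaves embLI (inv f) ≡ embRI f
  embLeaves-inv (∧R f g)  = cong₂ ∧R (embLeaves-inv f) (embLeaves-inv g)
  embLeaves-inv (LI2RI f) = refl

  embF-withTag : (h : T ∣ Γ ⊢F P) → embF {T = T} (withTag {T = T} h) ≡ embF {T = T} {P = P} h
  embF-withTag (pass f)   = refl
  embF-withTag ax         = refl
  embF-withTag IR         = refl
  embF-withTag (⊗R f g v) = refl
  embF-withTag (∨R₁ f v)  = refl
  embF-withTag (∨R₂ f v)  = refl
  embF-withTag (∧L₁ f)    = refl
  embF-withTag (∧L₂ f)    = refl

  embRI-build : (hs : Leaves (T ∣ Γ ⊢F_) A) → embRI (build {T = T} hs) ≡ embLeaves (embF {T = T}) hs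
  embRI-build (leaf h)     = embF-withTag h
  embRI-build (node hs ks) = cong₂ ∧R (embRI-build hs) (embRI-build ks)

  -- Draws a rule `r` common to all leaves out of the tree of `∧R`'s. It is polymorphic in the
  -- succedent because it acts at every conjunct; the identity is also an instance.
  embLeaves-mapLeaves :
    {Q R : NonNegFml → Set} {S′ : Stoup} {Γ′ : Cxt}
    {k : ∀ {P} → R P → S′ ∣ Γ′ ⊢ fml P} {k′ : ∀ {P} → Q P → S ∣ Γ ⊢ fml P} {j : ∀ {P} → Q P → R P}
    (r : ∀ {C} → S ∣ Γ ⊢ C → S′ ∣ Γ′ ⊢ C) →
    (∀ {B C} {f : S ∣ Γ ⊢ B} {g : S ∣ Γ ⊢ C} → r (∧R f g) ≗ ∧R (r f) (r g)) →
    (∀ {P} (q : Q P) → k (j q) ≗ r (k′ q)) →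
    (qs : Leaves Q A) → embLeaves k (mapLeaves j qs) ≗ r (embLeaves k′ qs)
  embLeaves-mapLeaves r r-∧R eq (leaf q)     = eq q
  embLeaves-mapLeaves r r-∧R eq (node qs rs) =
    ≗trans (cong-∧R (embLeaves-mapLeaves r r-∧R eq qs) (embLeaves-mapLeaves r r-∧R eq rs))
           (≗sym r-∧R)

  -- `F2LI` demands an irreducible stoup, so every leaf ends with `IL`, and `IL-∧R` collects these
  -- into one.
  embLeaves-IL : (fs : Leaves (just I ∣ Γ ⊢LI_) A) →
                 embLeaves embLI fs ≗ IL (embLeaves embLI (mapLeaves unIL fs))
  embLeaves-IL (leaf (IL f))                  = ≗refl
  embLeaves-IL (leaf (F2LI {T = irr _ ()} _))
  embLeaves-IL (node fs gs)                   =
    ≗trans (cong-∧R (embLeaves-IL fs) (embLeaves-IL gs)) (≗sym IL-∧R)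

  embLeaves-⊗L : (fs : Leaves (just (B ⊗ C) ∣ Γ ⊢LI_) A) →
                 embLeaves embLI fs ≗ ⊗L (embLeaves embLI (mapLeaves un⊗L fs))
  embLeaves-⊗L (leaf (⊗L f))                  = ≗refl
  embLeaves-⊗L (leaf (F2LI {T = irr _ ()} _))
  embLeaves-⊗L (node fs gs)                   =
    ≗trans (cong-∧R (embLeaves-⊗L fs) (embLeaves-⊗L gs)) (≗sym ⊗L-∧R)

  embLeaves-∨L : (fs : Leaves (just (B ∨ C) ∣ Γ ⊢LI_) A) →
                 embLeaves embLI fs ≗
                 ∨L (embLeaves embLI (mapLeaves un∨L₁ fs)) (embLeaves embLI (mapLeaves un∨L₂ fs))
  embLeaves-∨L (leaf (∨L f g))                = ≗refl
  embLeaves-∨L (leaf (F2LI {T = irr _ ()} _))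
  embLeaves-∨L (node fs gs)                   =
    ≗trans (cong-∧R (embLeaves-∨L fs) (embLeaves-∨L gs)) (≗sym ∨L-∧R)

  embLI-unF2LI : (T : IrrStoup) (f : stoup T ∣ Γ ⊢LI P) → embF {T = T} (unF2LI T f) ≡ embLI {P = P} f
  embLI-unF2LI (irr nothing _)        (F2LI h) = refl
  embLI-unF2LI (irr (just (` _)) _)   (F2LI h) = refl
  embLI-unF2LI (irr (just (_ ∧ _)) _) (F2LI h) = refl
  embLI-unF2LI (irr (just I) ())
  embLI-unF2LI (irr (just (_ ⊗ _)) ())
  embLI-unF2LI (irr (just (_ ∨ _)) ())

  embLeaves-unF2LI : (T : IrrStoup) (fs : Leaves (stoup T ∣ Γ ⊢LI_) A) →
                     embLeaves (embF {T = T}) (mapLeaves (unF2LI T) fs) ≗ embLeaves embLI fs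
  embLeaves-unF2LI T fs =
    embLeaves-mapLeaves (λ f → f) ≗refl (λ f → ≡⇒≗ (embLI-unF2LI T f)) fs

  -- The counterpart of `apply` in the unfocused calculus; the second premise stored in `⊗R g` is
  -- focused and must be embedded.
  applyRule : (ρ : RightRule A) → S ∣ Γ ⊢ A → S ∣ cxt ρ Γ ⊢ fml (concl ρ)
  applyRule (∨R₁ _) f = ∨R₁ f
  applyRule (∨R₂ _) f = ∨R₂ f
  applyRule (⊗R g)  f = ⊗R f (embRI g)

  applyRule-cong : (ρ : RightRule A) {f g : S ∣ Γ ⊢ A} → f ≗ g → applyRule ρ f ≗ applyRule ρ g
  applyRule-cong (∨R₁ _) p = cong-∨R₁ p
  applyRule-cong (∨R₂ _) p = cong-∨R₂ p
  applyRule-cong (⊗R _)  p = cong-⊗R p ≗refl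

  applyRule-IL : (ρ : RightRule A) {f : nothing ∣ Γ ⊢ A} →
                 IL (applyRule ρ f) ≗ applyRule ρ (IL f)
  applyRule-IL (∨R₁ _) = ≗sym ∨R₁-IL
  applyRule-IL (∨R₂ _) = ≗sym ∨R₂-IL
  applyRule-IL (⊗R _)  = ≗sym ⊗R-IL

  applyRule-∧L₁ : (ρ : RightRule A) {f : just B ∣ Γ ⊢ A} →
                  ∧L₁ {B = C} (applyRule ρ f) ≗ applyRule ρ (∧L₁ f)
  applyRule-∧L₁ (∨R₁ _) = ≗sym ∨R₁-∧L₁
  applyRule-∧L₁ (∨R₂ _) = ≗sym ∨R₂-∧L₁
  applyRule-∧L₁ (⊗R _)  = ≗sym ⊗R-∧L₁

  applyRule-∧L₂ : (ρ : RightRule A) {f : just C ∣ Γ ⊢ A} →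
                  ∧L₂ {A = B} (applyRule ρ f) ≗ applyRule ρ (∧L₂ f)
  applyRule-∧L₂ (∨R₁ _) = ≗sym ∨R₁-∧L₂
  applyRule-∧L₂ (∨R₂ _) = ≗sym ∨R₂-∧L₂
  applyRule-∧L₂ (⊗R _)  = ≗sym ⊗R-∧L₂

  applyRule-∨L : (ρ : RightRule A) {f : just B ∣ Γ ⊢ A} {g : just C ∣ Γ ⊢ A} →
                 ∨L (applyRule ρ f) (applyRule ρ g) ≗ applyRule ρ (∨L f g)
  applyRule-∨L (∨R₁ _) = ≗sym ∨R₁-∨L
  applyRule-∨L (∨R₂ _) = ≗sym ∨R₂-∨L
  applyRule-∨L (⊗R _)  = ≗sym ⊗R-∨L

  -- The congruence step is built in: the `subst` disappears only after splitting on `ρ`, so `p` has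
  -- to be available there.
  applyRule-⊗L : (ρ : RightRule A) {f : just B ∣ C ∷ Γ ⊢ A}
                 (h : just B ∣ cxt ρ (C ∷ Γ) ⊢LI concl ρ) → embLI h ≗ applyRule ρ f →
                 ⊗L (embLI (subst (just _ ∣_⊢LI concl ρ) (cxt-∷ ρ) h)) ≗ applyRule ρ (⊗L f)
  applyRule-⊗L (∨R₁ _) h p = ≗trans (cong-⊗L p) (≗sym ∨R₁-⊗L)
  applyRule-⊗L (∨R₂ _) h p = ≗trans (cong-⊗L p) (≗sym ∨R₂-⊗L)
  applyRule-⊗L (⊗R _)  h p = ≗trans (cong-⊗L p) (≗sym ⊗R-⊗L)

  applyRule-pass : (ρ : RightRule A) {f : just B ∣ Γ ⊢ A}
                   (h : just B ∣ cxt ρ Γ ⊢LI concl ρ) → embLI h ≗ applyRule ρ f →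
                   embF {T = irr nothing tt}
                        (subst (irr nothing tt ∣_⊢F concl ρ) (sym (cxt-∷ ρ)) (pass h)) ≗
                   applyRule ρ (pass f)
  applyRule-pass (∨R₁ _) h p = ≗trans (cong-pass p) (≗sym ∨R₁-pass)
  applyRule-pass (∨R₂ _) h p = ≗trans (cong-pass p) (≗sym ∨R₂-pass)
  applyRule-pass (⊗R _)  h p = ≗trans (cong-pass p) (≗sym ⊗R-pass)

  embF-apply : (ρ : RightRule A) {l : List Tag} (f : stoup T ∣ Γ ⊢RI[ l ] A) .(v : Valid l) →
               embF {T = T} (apply {T = T} ρ f v) ≡ applyRule ρ (embRI f)
  embF-apply (∨R₁ _) f v = refl
  embF-apply (∨R₂ _) f v = refl
  embF-apply (⊗R _)  f v = refl

  module _ (ρ : RightRule A) where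

    -- Mutual induction along `rightLI`, `rightIrr` and `same`. The decomposition is handed on
    -- unchanged between them and shrinks whenever a left rule is peeled off.
    embLI-rightLI  : (d : Decomp S Γ) (fs : Leaves (S ∣ Γ ⊢LI_) A) →
                     embLI (rightLI ρ d fs) ≗ applyRule ρ (embLeaves embLI fs)
    embLI-rightIrr : (d : Decomp (stoup T) Γ) (hs : Leaves (T ∣ Γ ⊢F_) A) →
                     embLI (rightIrr ρ {T = T} d hs) ≗ applyRule ρ (embLeaves (embF {T = T}) hs)
    embF-same      : (d : Decomp (stoup T) Γ) {hs : Leaves (T ∣ Γ ⊢F_) A} (s : SameRule hs) →
                     embF {T = T} (same ρ {T = T} d s) ≗ applyRule ρ (embLeaves (embF {T = T}) hs)

    embLI-rightLI (IL d)     fs =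
      ≗trans (cong-IL (embLI-rightLI d _))
             (≗trans (applyRule-IL ρ) (applyRule-cong ρ (≗sym (embLeaves-IL fs))))
    embLI-rightLI (⊗L d)     fs =
      ≗trans (applyRule-⊗L ρ _ (embLI-rightLI d _)) (applyRule-cong ρ (≗sym (embLeaves-⊗L fs)))
    embLI-rightLI (∨L d₁ d₂) fs =
      ≗trans (cong-∨L (embLI-rightLI d₁ _) (embLI-rightLI d₂ _))
             (≗trans (applyRule-∨L ρ) (applyRule-cong ρ (≗sym (embLeaves-∨L fs))))
    embLI-rightLI d@empty    fs =
      ≗trans (embLI-rightIrr d (mapLeaves (unF2LI (irr _ tt)) fs))
             (applyRule-cong ρ (embLeaves-unF2LI (irr _ tt) fs))
    embLI-rightLI d@(pass _) fs =
      ≗trans (embLI-rightIrr d (mapLeaves (unF2LI (irr _ tt)) fs))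
             (applyRule-cong ρ (embLeaves-unF2LI (irr _ tt) fs))
    embLI-rightLI d@atom     fs =
      ≗trans (embLI-rightIrr d (mapLeaves (unF2LI (irr _ tt)) fs))
             (applyRule-cong ρ (embLeaves-unF2LI (irr _ tt) fs))
    embLI-rightLI d@(∧L _ _) fs =
      ≗trans (embLI-rightIrr d (mapLeaves (unF2LI (irr _ tt)) fs))
             (applyRule-cong ρ (embLeaves-unF2LI (irr _ tt) fs))

    embLI-rightIrr {T = T} d hs with valid? (tags hs)
    -- No rule moves when the tags are valid, so embedding commutes here up to `≡`; permutations
    -- enter only in the other case.
    ... | yes v = ≡⇒≗ (trans (embF-apply {T = T} ρ (build {T = T} hs) v) (cong (applyRule ρ) (embRI-build hs)))
    ... | no ¬v = embF-same {T = T} d (sameRule hs ¬v)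

    embF-same (pass d) (all-pass fs) =
      ≗trans (applyRule-pass ρ (rightLI ρ d fs) (embLI-rightLI d fs))
             (applyRule-cong ρ (≗sym (embLeaves-mapLeaves pass pass-∧R (λ _ → ≗refl) fs)))
    embF-same (∧L d _) (all-∧L₁ fs)  =
      ≗trans (≗trans (cong-∧L₁ (embLI-rightLI d fs)) (applyRule-∧L₁ ρ))
             (applyRule-cong ρ (≗sym (embLeaves-mapLeaves ∧L₁ ∧L₁-∧R (λ _ → ≗refl) fs)))
    embF-same (∧L _ d) (all-∧L₂ fs)  =
      ≗trans (≗trans (cong-∧L₂ (embLI-rightLI d fs)) (applyRule-∧L₂ ρ))
             (applyRule-cong ρ (≗sym (embLeaves-mapLeaves ∧L₂ ∧L₂-∧R (λ _ → ≗refl) fs)))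

    embRI-rightRI : (f : S ∣ Γ ⊢RI A) → embRI (rightRI ρ f) ≗ applyRule ρ (embRI f)
    embRI-rightRI f =
      ≗trans (embLI-rightLI (decomp _ _) (inv f)) (≡⇒≗ (cong (applyRule ρ) (embLeaves-inv f)))

  -- Embedding after focusing.

  embRI-axRI : (A : Fml) → embRI (axRI A) ≗ ax
  embRI-axRI (` _)   = ≗refl
  -- `axRI` is fully eta-expanded, so each compound case closes with the eta-equation of its
  -- connective read backwards.
  embRI-axRI I       = ≗sym axI
  embRI-axRI (A ⊗ B) =
    ≗trans (embRI-⊗LRI (⊗RRI (axRI A) (passRI (axRI B))))
    (≗trans (cong-⊗L (≗trans (embRI-rightRI (⊗R (passRI (axRI B))) (axRI A))
                             (cong-⊗R (embRI-axRI A)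
                                      (≗trans (embRI-passRI (axRI B)) (cong-pass (embRI-axRI B))))))
            (≗sym ax⊗))
  embRI-axRI (A ∧ B) =
    ≗trans (cong-∧R (≗trans (embRI-∧L₁RI (axRI A)) (cong-∧L₁ (embRI-axRI A)))
                    (≗trans (embRI-∧L₂RI (axRI B)) (cong-∧L₂ (embRI-axRI B))))
           (≗sym ax∧)
  embRI-axRI (A ∨ B) =
    ≗trans (embRI-∨LRI (∨R₁RI (axRI A)) (∨R₂RI (axRI B)))
    (≗trans (cong-∨L (≗trans (embRI-rightRI (∨R₁ B) (axRI A)) (cong-∨R₁ (embRI-axRI A)))
                     (≗trans (embRI-rightRI (∨R₂ A) (axRI B)) (cong-∨R₂ (embRI-axRI B))))
            (≗sym ax∨))

  embRI-focus : (f : S ∣ Γ ⊢ A) → embRI (focus f) ≗ f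
  embRI-focus ax       = embRI-axRI _
  embRI-focus (pass f) = ≗trans (embRI-passRI (focus f)) (cong-pass (embRI-focus f))
  embRI-focus (IL f)   = ≗trans (embRI-ILRI (focus f)) (cong-IL (embRI-focus f))
  embRI-focus IR       = ≗refl
  embRI-focus (⊗L f)   = ≗trans (embRI-⊗LRI (focus f)) (cong-⊗L (embRI-focus f))
  embRI-focus (⊗R f g) =
    ≗trans (embRI-rightRI (⊗R (focus g)) (focus f)) (cong-⊗R (embRI-focus f) (embRI-focus g))
  embRI-focus (∧L₁ f)  = ≗trans (embRI-∧L₁RI (focus f)) (cong-∧L₁ (embRI-focus f))
  embRI-focus (∧L₂ f)  = ≗trans (embRI-∧L₂RI (focus f)) (cong-∧L₂ (embRI-focus f))
  embRI-focus (∧R f g) = cong-∧R (embRI-focus f) (embRI-focus g)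
  embRI-focus (∨L f g) =
    ≗trans (embRI-∨LRI (focus f) (focus g)) (cong-∨L (embRI-focus f) (embRI-focus g))
  embRI-focus (∨R₁ f)  = ≗trans (embRI-rightRI (∨R₁ _) (focus f)) (cong-∨R₁ (embRI-focus f))
  embRI-focus (∨R₂ f)  = ≗trans (embRI-rightRI (∨R₂ _) (focus f)) (cong-∨R₂ (embRI-focus f))

  -- Erasing tags and recovering them from leaves.

  untagF : {t : Tag? m} → F m t T Γ P → T ∣ Γ ⊢F P
  untagF (pass f)   = pass f
  untagF ax         = ax
  untagF IR         = IR
  -- Only the tag of the conclusion goes: the premise `f` keeps its list, to which `v` refers.
  untagF (⊗R f g v) = ⊗R f g v
  untagF (∨R₁ f v)  = ∨R₁ f v
  untagF (∨R₂ f v)  = ∨R₂ f v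
  untagF (∧L₁ f)    = ∧L₁ f
  untagF (∧L₂ f)    = ∧L₂ f

  untagLI : {t : Tag? m} → LI m t S Γ P → S ∣ Γ ⊢LI P
  untagLI (IL f)           = IL f
  untagLI (⊗L f)           = ⊗L f
  untagLI (∨L f g)         = ∨L f g
  untagLI (F2LI {T = T} f) = F2LI {T = T} (untagF f)

  -- `embRI` forgets tags, so focusing an embedded tagged derivation can return only its untagged
  -- version.
  untagRI : {l : Tags? m} → RI m l S Γ A → S ∣ Γ ⊢RI A
  untagRI (∧R f g)  = ∧R (untagRI f) (untagRI g)
  untagRI (LI2RI f) = LI2RI (untagLI f)

  untagF-untagged : (f : T ∣ Γ ⊢F P) → untagF {T = T} f ≡ f
  untagF-untagged (pass f)   = refl
  untagF-untagged ax         = refl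
  untagF-untagged IR         = refl
  untagF-untagged (⊗R f g v) = refl
  untagF-untagged (∨R₁ f v)  = refl
  untagF-untagged (∨R₂ f v)  = refl
  untagF-untagged (∧L₁ f)    = refl
  untagF-untagged (∧L₂ f)    = refl

  untagLI-untagged : (f : S ∣ Γ ⊢LI P) → untagLI f ≡ f
  untagLI-untagged (IL f)           = refl
  untagLI-untagged (⊗L f)           = refl
  untagLI-untagged (∨L f g)         = refl
  untagLI-untagged (F2LI {T = T} f) = cong (F2LI {T = T}) (untagF-untagged f)

  untagRI-untagged : (f : S ∣ Γ ⊢RI A) → untagRI f ≡ f
  untagRI-untagged (∧R f g)  = cong₂ ∧R (untagRI-untagged f) (untagRI-untagged g)
  untagRI-untagged (LI2RI f) = cong LI2RI (untagLI-untagged f)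

  untagF-withTag : (h : T ∣ Γ ⊢F P) → untagF {T = T} (withTag {T = T} h) ≡ h
  untagF-withTag (pass f)   = refl
  untagF-withTag ax         = refl
  untagF-withTag IR         = refl
  untagF-withTag (⊗R f g v) = refl
  untagF-withTag (∨R₁ f v)  = refl
  untagF-withTag (∨R₂ f v)  = refl
  untagF-withTag (∧L₁ f)    = refl
  untagF-withTag (∧L₂ f)    = refl

  inv-untagRI-build : (hs : Leaves (T ∣ Γ ⊢F_) A) →
                      inv (untagRI (build {T = T} hs)) ≡ mapLeaves (λ h → F2LI {T = T} h) hs
  inv-untagRI-build {T = T} (leaf h) = cong (λ h → leaf (F2LI {T = T} h)) (untagF-withTag h)
  inv-untagRI-build (node hs ks) = cong₂ node (inv-untagRI-build hs) (inv-untagRI-build ks)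

  -- A view rather than an equation: matching on `built hs` replaces the index `l` by `tags hs`
  -- together with `f`.
  data BuildView {T : IrrStoup} {Γ : Cxt} {A : Fml} : {l : List Tag} → stoup T ∣ Γ ⊢RI[ l ] A → Set where
    built : (hs : Leaves (T ∣ Γ ⊢F_) A) → BuildView {T = T} (build {T = T} hs)

  -- Below its leaves a tagged derivation has only `∧R`'s, and the tag of a leaf is determined by
  -- its last rule, so `withTag` restores it. Splitting on `T` makes the stoup concrete, and
  -- splitting on the rule makes `tagOf` reduce to that tag.
  buildView : {l : List Tag} (f : stoup T ∣ Γ ⊢RI[ l ] A) → BuildView {T = T} f
  buildView {T = T} (∧R f g) with buildView {T = T} f | buildView {T = T} g
  ... | built hs | built ks = built (node hs ks)
  buildView {T = irr nothing _}        (LI2RI (F2LI (pass f)))   = built (leaf (pass f))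
  buildView {T = irr nothing _}        (LI2RI (F2LI IR))         = built (leaf IR)
  buildView {T = irr nothing _}        (LI2RI (F2LI (⊗R f g v))) = built (leaf (⊗R f g v))
  buildView {T = irr nothing _}        (LI2RI (F2LI (∨R₁ f v)))  = built (leaf (∨R₁ f v))
  buildView {T = irr nothing _}        (LI2RI (F2LI (∨R₂ f v)))  = built (leaf (∨R₂ f v))
  buildView {T = irr (just (` _)) _}   (LI2RI (F2LI ax))         = built (leaf ax)
  buildView {T = irr (just (` _)) _}   (LI2RI (F2LI (⊗R f g v))) = built (leaf (⊗R f g v))
  buildView {T = irr (just (` _)) _}   (LI2RI (F2LI (∨R₁ f v)))  = built (leaf (∨R₁ f v))
  buildView {T = irr (just (` _)) _}   (LI2RI (F2LI (∨R₂ f v)))  = built (leaf (∨R₂ f v))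
  buildView {T = irr (just (_ ∧ _)) _} (LI2RI (F2LI (⊗R f g v))) = built (leaf (⊗R f g v))
  buildView {T = irr (just (_ ∧ _)) _} (LI2RI (F2LI (∨R₁ f v)))  = built (leaf (∨R₁ f v))
  buildView {T = irr (just (_ ∧ _)) _} (LI2RI (F2LI (∨R₂ f v)))  = built (leaf (∨R₂ f v))
  buildView {T = irr (just (_ ∧ _)) _} (LI2RI (F2LI (∧L₁ f)))    = built (leaf (∧L₁ f))
  buildView {T = irr (just (_ ∧ _)) _} (LI2RI (F2LI (∧L₂ f)))    = built (leaf (∧L₂ f))
  buildView {T = irr (just I) ()} (LI2RI _)
  buildView {T = irr (just (_ ⊗ _)) ()} (LI2RI _)
  buildView {T = irr (just (_ ∨ _)) ()} (LI2RI _)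

  -- Once `f` is `build hs`, `v` is exactly the condition tested by `rightIrr`, which therefore
  -- applies `ρ` at once to the premise rebuilt from `hs`, namely `f` with its tags.
  rightRI-untagRI : (T : IrrStoup) (ρ : RightRule A) {l : List Tag} (f : stoup T ∣ Γ ⊢RI[ l ] A)
                    .(v : Valid l) → rightRI ρ (untagRI f) ≡ LI2RI (F2LI {T = T} (apply {T = T} ρ f v))
  rightRI-untagRI T ρ f v with buildView {T = T} f
  ... | built hs =
    cong LI2RI (trans (cong (rightLI ρ (decomp (stoup T) _)) (inv-untagRI-build hs))
               (trans (rightLI-F2LI ρ T (decomp (stoup T) _) hs)
                      (rightIrr-valid ρ (decomp (stoup T) _) hs v)))

  -- Focusing after embedding.

  -- Premises of right rules are tagged even inside untagged derivations, so the induction ranges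
  -- over both modes; the untagged corollaries take part in the recursion to treat untagged
  -- premises.
  focus-embRI          : {l : Tags? m} (f : RI m l S Γ A) → focus (embRI f) ≡ untagRI f
  focus-embLI          : {t : Tag? m} (f : LI m t S Γ P) → focus (embLI f) ≡ LI2RI (untagLI f)
  focus-embF           : {t : Tag? m} (f : F m t T Γ P) →
                         focus (embF {T = T} f) ≡ LI2RI (F2LI {T = T} (untagF f))
  focus-embRI-untagged : (f : S ∣ Γ ⊢RI A) → focus (embRI f) ≡ f
  focus-embLI-untagged : (f : S ∣ Γ ⊢LI P) → focus (embLI f) ≡ LI2RI f

  focus-embRI (∧R f g)  = cong₂ ∧R (focus-embRI f) (focus-embRI g)
  focus-embRI (LI2RI f) = focus-embLI f

  focus-embLI (IL f)           = cong ILRI (focus-embLI-untagged f)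
  focus-embLI (⊗L f)           = cong ⊗LRI (focus-embLI-untagged f)
  focus-embLI (∨L f g)         = cong₂ ∨LRI (focus-embLI-untagged f) (focus-embLI-untagged g)
  focus-embLI (F2LI {T = T} f) = focus-embF {T = T} f

  focus-embF (pass f)           = cong passRI (focus-embLI-untagged f)
  focus-embF ax                 = refl
  focus-embF IR                 = refl
  focus-embF {T = T} (⊗R f g v) =
    -- The left premise comes back without tags and the right one unchanged; `rightRI-untagRI` puts
    -- the tags back.
    trans (cong₂ ⊗RRI (focus-embRI f) (focus-embRI-untagged g)) (rightRI-untagRI T (⊗R g) f v)
  focus-embF {T = T} (∨R₁ f v)  =
    trans (cong ∨R₁RI (focus-embRI f)) (rightRI-untagRI T (∨R₁ _) f v)
  focus-embF {T = T} (∨R₂ f v)  =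
    trans (cong ∨R₂RI (focus-embRI f)) (rightRI-untagRI T (∨R₂ _) f v)
  focus-embF (∧L₁ f)            = cong ∧L₁RI (focus-embLI-untagged f)
  focus-embF (∧L₂ f)            = cong ∧L₂RI (focus-embLI-untagged f)

  focus-embRI-untagged f = trans (focus-embRI f) (untagRI-untagged f)

  focus-embLI-untagged f = trans (focus-embLI f) (cong LI2RI (untagLI-untagged f))

theorem4p5 : (At : Set) → let open Calculus At in
    (S : Stoup) (Γ : Cxt) (A : Fml) →
    ((f g : S ∣ Γ ⊢ A) → f ≗ g → focus f ≡ focus g)
    × ((f : S ∣ Γ ⊢ A) → embRI (focus f) ≗ f)
    × ((f : S ∣ Γ ⊢RI A) → focus (embRI f) ≡ f)
theorem4p5 At S Γ A = (λ _ _ → focus-resp-≗) , embRI-focus , focus-embRI-untagged
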